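{- Let $G=(V,E)$ be an undirected graph with $n=|V|$ vertices and $m=|E|$ edges, and let $\bar\delta$ be its average degeneracy. Counting the 4-cycles incident to each edge of $G$ (that is, computing $\square(e)$ for all $e\in E$) takes $O(m\bar\delta)$ time and $O(m+n)$ space; i.e. there is an algorithm which, given any such $G$, computes all the values $\square(e)$, $e\in E$, within these bounds.
   Context: Graphs are finite, simple and undirected, with vertices labeled by $[n]=\{1,\dots,n\}$; $N(v)=\{u: uv\in E\}$ and $d(v)=|N(v)|$. The average degeneracy is $\bar\delta=\frac1m\sum_{uv\in E}\min\{d(u),d(v)\}$. A 4-cycle ($C_4$) is a sequence of four distinct vertices $x,y,z,w$ with $xy,yz,zw,wx\in E$; the eight sequences obtained from it by cyclic shifts and reversal count as a single distinct 4-cycle. $\square(e)$ denotes the number of distinct 4-cycles of $G$ containing the edge $e$. Computational model: the input graph is given in adjacency-list form, with an arbitrary ordering of the neighbors of each vertex; vertex degrees can be looked up in constant time; array access, comparison and addition on words take constant time. Time bounds are worst-case bounds for deterministic algorithms (no hashing or randomness). Space is measured in words and does not include the storage of the input graph. -}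

module Defs where

open import Level using (0ℓ)
open import Data.Nat using (ℕ; zero; suc; _+_; _⊓_; _<_)
open import Data.Integer using (+_)
open import Data.Rational using (ℚ; 0ℚ; _/_)
open import Data.Fin as Fin using (Fin; toℕ)
open import Data.Fin.Properties as Finₚ using ()
open import Data.List as List
  using (List; []; _∷_; _++_; length; map; filter; take; concatMap;
         cartesianProduct; allFin; deduplicate)
open import Data.Nat.ListAction using (sum)
open import Data.List.Membership.Propositional using (_∈_)
open import Data.List.Membership.DecPropositional as DecMembership using ()
open import Data.List.Relation.Unary.Unique.Propositional using (Unique)
open import Data.List.Relation.Unary.AllPairs using (allPairs?)
open import Data.List.Relation.Binary.Permutation.Propositional using (_↭_)
open import Data.Vec as Vec using (Vec; lookup; _[_]≔_)
open import Data.Product using (_×_; _,_)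
open import Data.Product.Properties using (≡-dec)
open import Data.Sum using (_⊎_)
open import Relation.Binary.Core using (Rel)
open import Relation.Binary.Definitions
  using (Decidable; DecidableEquality; Symmetric; Irreflexive)
open import Relation.Binary.PropositionalEquality using (_≡_)
open import Relation.Nullary using (¬_; Dec)
open import Relation.Nullary.Decidable using (¬?; _×-dec_; _⊎-dec_)

fromℕ : ℕ → ℚ
fromℕ a = + a / 1

-- Only the value at a zero denominator is a convention.
_÷_ : ℕ → ℕ → ℚ
a ÷ zero  = 0ℚ
a ÷ suc b = + a / suc b

record Graph (n : ℕ) : Set₁ where
  field
    Adj         : Rel (Fin n) 0ℓ
    adj?        : Decidable Adj
    symmetric   : Symmetric Adj
    irreflexive : Irreflexive _≡_ Adj

module _ {n : ℕ} (G : Graph n) where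
  open Graph G

  neighbours : Fin n → List (Fin n)
  neighbours v = filter (adj? v) (allFin n)

  degree : Fin n → ℕ
  degree v = length (neighbours v)

  -- Each undirected edge is listed once, smaller endpoint first.
  edges : List (Fin n × Fin n)
  edges = filter (λ (u , v) → (u Finₚ.<? v) ×-dec adj? u v)
                 (cartesianProduct (allFin n) (allFin n))

  edgeCount : ℕ
  edgeCount = length edges

  -- For an edgeless graph this is 0, by the convention in _÷_.
  averageDegeneracy : ℚ
  averageDegeneracy = sum (map (λ (u , v) → degree u ⊓ degree v) edges) ÷ edgeCount

Seq4 : ℕ → Set
Seq4 n = Fin n × Fin n × Fin n × Fin n

module _ {n : ℕ} where

  _≟₄_ : DecidableEquality (Seq4 n)
  _≟₄_ = ≡-dec Finₚ._≟_ (≡-dec Finₚ._≟_ (≡-dec Finₚ._≟_ Finₚ._≟_))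

  shift reversal : Seq4 n → Seq4 n
  shift    (x , y , z , w) = y , z , w , x
  reversal (x , y , z , w) = w , z , y , x

  shifts : Seq4 n → List (Seq4 n)
  shifts s = s ∷ shift s ∷ shift (shift s) ∷ shift (shift (shift s)) ∷ []

  _≈₄_ : Rel (Seq4 n) 0ℓ
  s ≈₄ s′ = s′ ∈ shifts s ++ shifts (reversal s)

  _≈₄?_ : Decidable _≈₄_
  s ≈₄? s′ = DecMembership._∈?_ _≟₄_ s′ (shifts s ++ shifts (reversal s))

  sides : Seq4 n → List (Fin n × Fin n)
  sides (x , y , z , w) = (x , y) ∷ (y , z) ∷ (z , w) ∷ (w , x) ∷ []

  Contains : Fin n → Fin n → Seq4 n → Set
  Contains u v s = (u , v) ∈ sides s ⊎ (v , u) ∈ sides s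

  contains? : ∀ u v s → Dec (Contains u v s)
  contains? u v s = ((u , v) ∈? sides s) ⊎-dec ((v , u) ∈? sides s)
    where open DecMembership (≡-dec (Finₚ._≟_ {n}) (Finₚ._≟_ {n})) using (_∈?_)

module _ {n : ℕ} (G : Graph n) where
  open Graph G

  IsC4 : Seq4 n → Set
  IsC4 (x , y , z , w) =
    Unique (x ∷ y ∷ z ∷ w ∷ []) × Adj x y × Adj y z × Adj z w × Adj w x

  isC4? : ∀ s → Dec (IsC4 s)
  isC4? (x , y , z , w) =
    allPairs? (λ a b → ¬? (a Finₚ.≟ b)) (x ∷ y ∷ z ∷ w ∷ [])
    ×-dec adj? x y ×-dec adj? y z ×-dec adj? z w ×-dec adj? w x

  allSeq4 : List (Seq4 n)
  allSeq4 = cartesianProduct V (cartesianProduct V (cartesianProduct V V))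
    where V = allFin n

  □ : Fin n → Fin n → ℕ
  □ u v = length (deduplicate _≈₄?_
            (filter (λ s → isC4? s ×-dec contains? u v s) allSeq4))

  record AdjacencyLists : Set where
    field
      nbrs   : Fin n → List (Fin n)
      nbrs-↭ : ∀ v → nbrs v ↭ neighbours G v

module _ {n : ℕ} {G : Graph n} (L : AdjacencyLists G) where
  open AdjacencyLists L

  degreeArray offsetArray adjacencyArray : List ℕ
  degreeArray    = map (degree G) (allFin n)
  offsetArray    = map (λ v → sum (map (degree G) (take (toℕ v) (allFin n)))) (allFin n)
  adjacencyArray = concatMap (λ v → map toℕ (nbrs v)) (allFin n)

  -- The list of v occupies the degreeArray[v] cells of adjacencyArray that
  -- start at offsetArray[v].
  encode : Vec (List ℕ) 3
  encode = degreeArray Vec.∷ offsetArray Vec.∷ adjacencyArray Vec.∷ Vec.[]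

  -- In the layout of adjacencyArray: the cell of the neighbour u in the list
  -- of v holds □(uv), so the value of an edge stands in both of its cells.
  edgeCounts : List ℕ
  edgeCounts = concatMap (λ v → map (□ G v) (nbrs v)) (allFin n)

-- A random access machine with i read-only input arrays, r registers and k
-- work arrays.  Constants are part of the program.

data Expr (i r k : ℕ) : Set where
  const : ℕ → Expr i r k
  copy  : Fin r → Expr i r k
  _⊕_   : Fin r → Fin r → Expr i r k
  size  : Fin i → Expr i r k
  input : Fin i → Fin r → Expr i r k
  load  : Fin k → Fin r → Expr i r k

data Test (r : ℕ) : Set where
  _≺_ _≐_ : Fin r → Fin r → Test r

infix  6 _≔_ _[_]≔ʷ_
infixr 5 _⨾_

data Program (i r k : ℕ) : Set where
  skip          : Program i r k
  _≔_           : Fin r → Expr i r k → Program i r k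
  _[_]≔ʷ_       : Fin k → Fin r → Fin r → Program i r k
  _⨾_           : Program i r k → Program i r k → Program i r k
  if_then_else_ : Test r → Program i r k → Program i r k → Program i r k
  while_run_     : Test r → Program i r k → Program i r k

-- Each of the k work arrays has S cells, so a state consists of r + k * S words.
record State (r k S : ℕ) : Set where
  constructor ⟨_,_⟩
  field
    regs : Vec ℕ r
    work : Vec (Vec ℕ S) k

Holds : ∀ {r} → Test r → Vec ℕ r → Set
Holds (x ≺ y) ρ = lookup ρ x < lookup ρ y
Holds (x ≐ y) ρ = lookup ρ x ≡ lookup ρ y

-- Accesses outside an array, and results that are not below the word bound W,
-- have no rule: such a run gets stuck and does not count as terminating.
module Semantics {i r k : ℕ} (inputs : Vec (List ℕ) i) (S W : ℕ) where

  data _⊢_⇓_ : State r k S → Expr i r k → ℕ → Set where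
    const : ∀ {s a} → s ⊢ const a ⇓ a
    copy  : ∀ {ρ μ x} → ⟨ ρ , μ ⟩ ⊢ copy x ⇓ lookup ρ x
    add   : ∀ {ρ μ x y} → ⟨ ρ , μ ⟩ ⊢ x ⊕ y ⇓ (lookup ρ x + lookup ρ y)
    size  : ∀ {s a} → s ⊢ size a ⇓ length (lookup inputs a)
    input : ∀ {ρ μ a x} (j : Fin (length (lookup inputs a))) →
            toℕ j ≡ lookup ρ x →
            ⟨ ρ , μ ⟩ ⊢ input a x ⇓ List.lookup (lookup inputs a) j
    load  : ∀ {ρ μ a x} (j : Fin S) →
            toℕ j ≡ lookup ρ x →
            ⟨ ρ , μ ⟩ ⊢ load a x ⇓ lookup (lookup μ a) j

  -- Run P s t s′ : started in s, the program P halts in s′ after t steps.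
  data Run : Program i r k → State r k S → ℕ → State r k S → Set where
    skip   : ∀ {s} → Run skip s 1 s
    assign : ∀ {ρ μ x e v} → ⟨ ρ , μ ⟩ ⊢ e ⇓ v → v < W →
             Run (x ≔ e) ⟨ ρ , μ ⟩ 1 ⟨ ρ [ x ]≔ v , μ ⟩
    store  : ∀ {ρ μ a x y} (j : Fin S) → toℕ j ≡ lookup ρ x →
             Run (a [ x ]≔ʷ y) ⟨ ρ , μ ⟩ 1
                 ⟨ ρ , μ [ a ]≔ (lookup μ a [ j ]≔ lookup ρ y) ⟩
    seq    : ∀ {P Q s s′ s″ t t′} → Run P s t s′ → Run Q s′ t′ s″ →
             Run (P ⨾ Q) s (t + t′) s″
    then′  : ∀ {b P Q s s′ t} → Holds b (State.regs s) → Run P s t s′ →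
             Run (if b then P else Q) s (suc t) s′
    else′  : ∀ {b P Q s s′ t} → ¬ Holds b (State.regs s) → Run Q s t s′ →
             Run (if b then P else Q) s (suc t) s′
    stop   : ∀ {b P s} → ¬ Holds b (State.regs s) → Run (while b run P) s 1 s
    loop   : ∀ {b P s s′ s″ t t′} → Holds b (State.regs s) →
             Run P s t s′ → Run (while b run P) s′ t′ s″ →
             Run (while b run P) s (suc (t + t′)) s″

{-# OPTIONS --safe #-}
module Submission where

-- Order the vertices by degree, ties broken by label (◁).  Every 4-cycle has a
-- unique ◁-largest vertex v; if w is the vertex opposite to v, then the cycle
-- consists of two wedges v u w and v x w with u, x, w ◁ v.  When there are c
-- wedges v u w with u ◁ v from v to w, each of them lies in c − 1 such cycles and
-- so contributes c − 1 to both of its edges.  Scanning these wedges, for all v,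
-- takes time Σ d(u) over the edges uv with u ◁ v, which is Σ min {d(u), d(v)}.
-- The contributions are added to the cells of v→u and u→w only, so that □(ab) is
-- the sum of the two cells of the edge ab; the cell of u→v is met, and linked to
-- that of v→u, while the list of u is scanned.

open import Defs

open import Data.Fin as Fin using (Fin; toℕ)
open import Data.Fin.Properties as Finₚ using (_≟_; toℕ<n; toℕ-injective; toℕ-fromℕ<)
open import Data.Integer as ℤ using ()
import Data.Integer.Properties as ℤₚ
open import Data.List as List using (List; []; _∷_; _++_; length; map; filter; take; concatMap; cartesianProduct; allFin; tabulate)
open import Data.List.Membership.Propositional using (_∈_; _∉_; find; lose)
open import Data.List.Membership.Propositional.Properties using (∈-∃++; ∈-++⁺ˡ; ∈-++⁺ʳ; ∈-++⁻; ∈-map⁺; ∈-map⁻; ∈-filter⁺; ∈-filter⁻; ∈-concatMap⁺; ∈-concatMap⁻; ∈-cartesianProduct⁺; ∈-allFin; ∈-deduplicate⁻)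
open import Data.List.Properties using (map-cong; map-∘; map-++; map-concatMap; concatMap-cong; length-map; length-++; length-filter; length-tabulate; ++-assoc; ++-identityʳ)
open import Data.List.Relation.Binary.Permutation.Propositional using (_↭_; ↭-sym; ↭⇒↭ₛ)
import Data.List.Relation.Binary.Permutation.Propositional.Properties as ↭ₚ
open import Data.List.Relation.Binary.Permutation.Setoid.Properties using (Unique-resp-↭)
open import Data.List.Relation.Unary.All as All using (All; []; _∷_)
import Data.List.Relation.Unary.All.Properties as Allₚ
open import Data.List.Relation.Unary.AllPairs as AllPairs using (AllPairs; []; _∷_)
import Data.List.Relation.Unary.AllPairs.Properties as AllPairsₚ
open import Data.List.Relation.Unary.Any as Any using (here; there)
import Data.List.Relation.Unary.Any.Properties as Anyₚ
open import Data.List.Relation.Unary.Unique.Propositional using (Unique)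
open import Data.List.Relation.Unary.Unique.Propositional.Properties as Uniqueₚ using (filter⁺; cartesianProduct⁺; allFin⁺)
import Data.List.Relation.Unary.Unique.DecSetoid.Properties as UniqueDecSetoid
open import Data.Nat as ℕ using (ℕ; zero; suc; _+_; _*_; _^_; _⊔_; _⊓_; _∸_; _≤_; _<_; z≤n; s≤s)
open import Data.Nat.ListAction using (sum)
open import Data.Nat.ListAction.Properties using (sum-++; sum-↭)
open import Data.Nat.Properties hiding (_≟_)
open import Algebra.Properties.CommutativeSemigroup +-commutativeSemigroup using (interchange)
open import Data.Nat.Solver using (module +-*-Solver)
open import Data.Product using (∃-syntax; Σ-syntax; _×_; _,_; proj₁; proj₂; uncurry; swap)
open import Data.Product.Properties using (≡-dec)
open import Data.Rational as ℚ using (ℚ; 1ℚ)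
import Data.Rational.Properties as ℚₚ
open import Data.Rational.Unnormalised as ℚᵘ using (mkℚᵘ; *≡*)
import Data.Rational.Unnormalised.Properties as ℚᵘₚ
open import Data.Sum using (_⊎_; inj₁; inj₂; [_,_]′)
open import Data.Vec as Vec using (Vec; []; _∷_; lookup; toList; _[_]≔_)
open import Function using (_∘_; id; case_of_)
open import Relation.Binary.Bundles using (DecSetoid)
open import Relation.Binary.Definitions using (tri<; tri≈; tri>)
open import Relation.Binary.PropositionalEquality
open import Relation.Nullary using (Dec; yes; no; ¬_; contradiction)
open import Relation.Nullary.Decidable using (_×-dec_; _⊎-dec_; ¬?; toSum)

private variable
  A B : Set
  P Q : Set

-- Positions in lists

infix 4 _[_]=_

data _[_]=_ {A : Set} : List A → ℕ → A → Set where
  here  : ∀ {x xs} → (x ∷ xs) [ 0 ]= x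
  there : ∀ {x y xs i} → xs [ i ]= y → (x ∷ xs) [ suc i ]= y

[]=⇒< : ∀ {xs : List A} {i x} → xs [ i ]= x → i < length xs
[]=⇒< here      = s≤s z≤n
[]=⇒< (there p) = s≤s ([]=⇒< p)

[]=⇒∈ : ∀ {xs : List A} {i x} → xs [ i ]= x → x ∈ xs
[]=⇒∈ here      = here refl
[]=⇒∈ (there p) = there ([]=⇒∈ p)

∈⇒[]= : ∀ {xs : List A} {x} → x ∈ xs → ∃[ i ] xs [ i ]= x
∈⇒[]= (here refl) = 0 , here
∈⇒[]= (there p)   = let i , q = ∈⇒[]= p in suc i , there q

[]=-functional : ∀ {xs : List A} {i x y} → xs [ i ]= x → xs [ i ]= y → x ≡ y
[]=-functional here      here      = refl
[]=-functional (there p) (there q) = []=-functional p q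

[]=-injective : ∀ {xs : List A} {i j x} → Unique xs → xs [ i ]= x → xs [ j ]= x → i ≡ j
[]=-injective _        here      here      = refl
[]=-injective (x∉ ∷ _) here      (there q) = contradiction refl (All.lookup x∉ ([]=⇒∈ q))
[]=-injective (x∉ ∷ _) (there p) here      = contradiction refl (All.lookup x∉ ([]=⇒∈ p))
[]=-injective (_ ∷ u)  (there p) (there q) = cong suc ([]=-injective u p q)

[]=-map : ∀ (f : A → B) {xs i x} → xs [ i ]= x → map f xs [ i ]= f x
[]=-map f here      = here
[]=-map f (there p) = there ([]=-map f p)

[]=-++ʳ : ∀ (xs : List A) {ys i y} → ys [ i ]= y → xs ++ ys [ length xs + i ]= y
[]=-++ʳ []       p = p
[]=-++ʳ (x ∷ xs) p = there ([]=-++ʳ xs p)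

[]=-++ˡ : ∀ {xs ys : List A} {i y} → xs [ i ]= y → xs ++ ys [ i ]= y
[]=-++ˡ here      = here
[]=-++ˡ (there p) = there ([]=-++ˡ p)

[]=-split : ∀ {xs : List A} ps {x qs} → xs ≡ ps ++ x ∷ qs → xs [ length ps ]= x
[]=-split ps {x} {qs} refl =
  subst (λ i → (ps ++ x ∷ qs) [ i ]= x) (+-identityʳ (length ps)) ([]=-++ʳ ps here)

[]=-concatMap : ∀ (f : A → List B) {xs i x k y} → xs [ i ]= x → f x [ k ]= y →
                concatMap f xs [ sum (map (length ∘ f) (take i xs)) + k ]= y
[]=-concatMap f here q = []=-++ˡ q
[]=-concatMap f {x′ ∷ xs} {k = k} {y} (there p) q =
  subst (λ i → concatMap f (x′ ∷ xs) [ i ]= y) (sym (+-assoc (length (f x′)) _ k)) ([]=-++ʳ (f x′) ([]=-concatMap f p q))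

[]=-tabulate : ∀ {n} (f : Fin n → A) v → tabulate f [ toℕ v ]= f v
[]=-tabulate f Fin.zero    = here
[]=-tabulate f (Fin.suc v) = there ([]=-tabulate (f ∘ Fin.suc) v)

[]=⇒lookup : ∀ {xs : List A} {i x} → xs [ i ]= x → ∃[ j ] (toℕ j ≡ i × List.lookup xs j ≡ x)
[]=⇒lookup here      = Fin.zero , refl , refl
[]=⇒lookup (there p) = let j , e , e′ = []=⇒lookup p in Fin.suc j , cong suc e , e′

-- Indicators and finite sums

𝟙 : Dec P → ℕ
𝟙 (yes _) = 1
𝟙 (no _)  = 0

𝟙-yes : (d : Dec P) → P → 𝟙 d ≡ 1
𝟙-yes (yes _) _ = refl
𝟙-yes (no ¬p) p = contradiction p ¬p

𝟙-no : (d : Dec P) → ¬ P → 𝟙 d ≡ 0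
𝟙-no (yes p) ¬p = contradiction p ¬p
𝟙-no (no _)  _  = refl

𝟙≤1 : (d : Dec P) → 𝟙 d ≤ 1
𝟙≤1 (yes _) = s≤s z≤n
𝟙≤1 (no _)  = z≤n

𝟙-cong : (d : Dec P) (e : Dec Q) → (P → Q) → (Q → P) → 𝟙 d ≡ 𝟙 e
𝟙-cong (yes p) e f g = sym (𝟙-yes e (f p))
𝟙-cong (no ¬p) e f g = sym (𝟙-no e (¬p ∘ g))

𝟙-× : (d : Dec P) (e : Dec Q) → 𝟙 (d ×-dec e) ≡ 𝟙 d * 𝟙 e
𝟙-× (yes _) (yes _) = refl
𝟙-× (yes _) (no _)  = refl
𝟙-× (no _)  _       = refl

𝟙-⊎ : (d : Dec P) (e : Dec Q) → ¬ (P × Q) → 𝟙 (d ⊎-dec e) ≡ 𝟙 d + 𝟙 e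
𝟙-⊎ (yes p) (yes q) ¬pq = contradiction (p , q) ¬pq
𝟙-⊎ (yes _) (no _)  _   = refl
𝟙-⊎ (no _)  (yes _) _   = refl
𝟙-⊎ (no _)  (no _)  _   = refl

∑ : List A → (A → ℕ) → ℕ
∑ xs f = sum (map f xs)

∑-cong : ∀ {f g : A → ℕ} → (∀ x → f x ≡ g x) → ∀ xs → ∑ xs f ≡ ∑ xs g
∑-cong f≗g xs = cong sum (map-cong f≗g xs)

∑-cong-∈ : ∀ {f g : A → ℕ} xs → (∀ {x} → x ∈ xs → f x ≡ g x) → ∑ xs f ≡ ∑ xs g
∑-cong-∈ []       _   = refl
∑-cong-∈ (x ∷ xs) f≗g = cong₂ _+_ (f≗g (here refl)) (∑-cong-∈ xs (f≗g ∘ there))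

∑-mono : ∀ {f g : A → ℕ} → (∀ x → f x ≤ g x) → ∀ xs → ∑ xs f ≤ ∑ xs g
∑-mono f≤g []       = z≤n
∑-mono f≤g (x ∷ xs) = +-mono-≤ (f≤g x) (∑-mono f≤g xs)

∑-mono-∈ : ∀ {f g : A → ℕ} xs → (∀ {x} → x ∈ xs → f x ≤ g x) → ∑ xs f ≤ ∑ xs g
∑-mono-∈ []       _   = z≤n
∑-mono-∈ (x ∷ xs) f≤g = +-mono-≤ (f≤g (here refl)) (∑-mono-∈ xs (f≤g ∘ there))

∑-++ : ∀ (f : A → ℕ) xs ys → ∑ (xs ++ ys) f ≡ ∑ xs f + ∑ ys f
∑-++ f xs ys = trans (cong sum (map-++ f xs ys)) (sum-++ (map f xs) (map f ys))

∑-∷ʳ : ∀ (f : A → ℕ) xs x → ∑ (xs ++ x ∷ []) f ≡ ∑ xs f + f x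
∑-∷ʳ f xs x = trans (∑-++ f xs (x ∷ [])) (cong (∑ xs f +_) (+-identityʳ (f x)))

∑-map : ∀ (g : A → B) (f : B → ℕ) xs → ∑ (map g xs) f ≡ ∑ xs (f ∘ g)
∑-map g f xs = cong sum (sym (map-∘ xs))

∑-concatMap : ∀ (g : A → List B) (f : B → ℕ) xs → ∑ (concatMap g xs) f ≡ ∑ xs (λ x → ∑ (g x) f)
∑-concatMap g f []       = refl
∑-concatMap g f (x ∷ xs) = trans (∑-++ f (g x) (concatMap g xs)) (cong (∑ (g x) f +_) (∑-concatMap g f xs))

∑-↭ : ∀ (f : A → ℕ) {xs ys} → xs ↭ ys → ∑ xs f ≡ ∑ ys f
∑-↭ f p = sum-↭ (↭ₚ.map⁺ f p)

∑-zero : ∀ (xs : List A) → ∑ xs (λ _ → 0) ≡ 0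
∑-zero []       = refl
∑-zero (_ ∷ xs) = ∑-zero xs

∑-+ : ∀ (f g : A → ℕ) xs → ∑ xs (λ x → f x + g x) ≡ ∑ xs f + ∑ xs g
∑-+ f g []       = refl
∑-+ f g (x ∷ xs) = trans (cong (f x + g x +_) (∑-+ f g xs)) (interchange (f x) (g x) _ _)

∑-*ˡ : ∀ c (f : A → ℕ) xs → ∑ xs (λ x → c * f x) ≡ c * ∑ xs f
∑-*ˡ c f []       = sym (*-zeroʳ c)
∑-*ˡ c f (x ∷ xs) = trans (cong (c * f x +_) (∑-*ˡ c f xs)) (sym (*-distribˡ-+ c (f x) _))

∑-swap : ∀ (f : A → B → ℕ) xs ys → ∑ xs (λ x → ∑ ys (f x)) ≡ ∑ ys (λ y → ∑ xs (λ x → f x y))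
∑-swap f []       ys = sym (∑-zero ys)
∑-swap f (x ∷ xs) ys = trans (cong (∑ ys (f x) +_) (∑-swap f xs ys)) (sym (∑-+ (f x) _ ys))

∑-const : ∀ (xs : List A) c → ∑ xs (λ _ → c) ≡ length xs * c
∑-const []       c = refl
∑-const (_ ∷ xs) c = cong (c +_) (∑-const xs c)

∑-≤ : ∀ {f : A → ℕ} {c} → (∀ x → f x ≤ c) → ∀ xs → ∑ xs f ≤ length xs * c
∑-≤ {c = c} f≤c xs = ≤-trans (∑-mono f≤c xs) (≤-reflexive (∑-const xs c))

∑-filter : ∀ {P : A → Set} (P? : ∀ x → Dec (P x)) (f : A → ℕ) xs →
           ∑ (filter P? xs) f ≡ ∑ xs (λ x → 𝟙 (P? x) * f x)
∑-filter P? f []       = refl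
∑-filter P? f (x ∷ xs) with P? x
... | yes _ = cong₂ _+_ (sym (*-identityˡ (f x))) (∑-filter P? f xs)
... | no _  = ∑-filter P? f xs

length-∑ : ∀ (xs : List A) → length xs ≡ ∑ xs (λ _ → 1)
length-∑ xs = sym (trans (∑-const xs 1) (*-identityʳ (length xs)))

length-concatMap : ∀ (f : A → List B) xs → length (concatMap f xs) ≡ ∑ xs (length ∘ f)
length-concatMap f []       = refl
length-concatMap f (x ∷ xs) = trans (length-++ (f x)) (cong (length (f x) +_) (length-concatMap f xs))

∑-cartesianProduct : ∀ (f : A × B → ℕ) xs ys →
                     ∑ (cartesianProduct xs ys) f ≡ ∑ xs (λ x → ∑ ys (λ y → f (x , y)))
∑-cartesianProduct f []       ys = refl
∑-cartesianProduct f (x ∷ xs) ys = trans (∑-++ f (map (x ,_) ys) _)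
  (cong₂ _+_ (∑-map (x ,_) f ys) (∑-cartesianProduct f xs ys))

∑-δ : ∀ (f : A → ℕ) {xs a} → Unique xs → a ∈ xs → (∀ {x} → x ≢ a → f x ≡ 0) → ∑ xs f ≡ f a
∑-δ f {x ∷ xs} (x∉ ∷ _) (here refl) z = trans (cong (f x +_)
  (trans (∑-cong-∈ xs (λ p → z (≢-sym (All.lookup x∉ p)))) (∑-zero xs))) (+-identityʳ (f x))
∑-δ f {_ ∷ xs} (x∉ ∷ u) (there p) z = trans (cong (_+ ∑ xs f) (z (All.lookup x∉ p))) (∑-δ f u p z)

-- 4-cycles through an edge

∉-uncons : ∀ {A : Set} (xs : List A) {x y ys} → y ∈ xs ++ x ∷ ys → y ≢ x → y ∈ xs ++ ys
∉-uncons xs y∈ y≢x with ∈-++⁻ xs y∈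
... | inj₁ y∈xs         = ∈-++⁺ˡ y∈xs
... | inj₂ (here y≡x)   = contradiction y≡x y≢x
... | inj₂ (there y∈ys) = ∈-++⁺ʳ xs y∈ys

length-≤-injective : ∀ {A B : Set} (_~_ : A → A → Set) (R : A → B → Set) →
                     (∀ {x x′ y} → R x y → R x′ y → x ~ x′) →
                     ∀ {xs ys} → AllPairs (λ x x′ → ¬ (x ~ x′)) xs →
                     (∀ {x} → x ∈ xs → ∃[ y ] (y ∈ ys × R x y)) → length xs ≤ length ys
length-≤-injective _~_ R inj []       f = z≤n
length-≤-injective _~_ R inj (x≁ ∷ u) f with f (here refl)
... | y , y∈ , xRy with ∈-∃++ y∈
... | ys₁ , ys₂ , refl = ≤-trans
  (s≤s (length-≤-injective _~_ R inj u λ x′∈ →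
    let y′ , y′∈ , x′Ry′ = f (there x′∈) in
    y′ , ∉-uncons ys₁ y′∈ (λ y′≡y → All.lookup x≁ x′∈ (inj xRy (subst (R _) y′≡y x′Ry′))) , x′Ry′))
  (≤-reflexive (trans (cong suc (length-++ ys₁)) (trans (sym (+-suc (length ys₁) _)) (sym (length-++ ys₁)))))

module _ {n : ℕ} where

  private
    pattern at₀ p = here p
    pattern at₁ p = there (here p)
    pattern at₂ p = there (there (here p))
    pattern at₃ p = there (there (there (here p)))
    pattern at₄ p = there (there (there (there (here p))))
    pattern at₅ p = there (there (there (there (there (here p)))))
    pattern at₆ p = there (there (there (there (there (there (here p))))))
    pattern at₇ p = there (there (there (there (there (there (there (here p)))))))

  ≈₄-refl : ∀ {s : Seq4 n} → s ≈₄ s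
  ≈₄-refl = at₀ refl

  ≈₄-shift : ∀ {s s′ : Seq4 n} → s ≈₄ s′ → s ≈₄ shift s′
  ≈₄-shift (at₀ refl) = at₁ refl
  ≈₄-shift (at₁ refl) = at₂ refl
  ≈₄-shift (at₂ refl) = at₃ refl
  ≈₄-shift (at₃ refl) = at₀ refl
  ≈₄-shift (at₄ refl) = at₅ refl
  ≈₄-shift (at₅ refl) = at₆ refl
  ≈₄-shift (at₆ refl) = at₇ refl
  ≈₄-shift (at₇ refl) = at₄ refl

  ≈₄-reversal : ∀ {s s′ : Seq4 n} → s ≈₄ s′ → s ≈₄ reversal s′
  ≈₄-reversal (at₀ refl) = at₄ refl
  ≈₄-reversal (at₁ refl) = at₇ refl
  ≈₄-reversal (at₂ refl) = at₆ refl
  ≈₄-reversal (at₃ refl) = at₅ refl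
  ≈₄-reversal (at₄ refl) = at₀ refl
  ≈₄-reversal (at₅ refl) = at₃ refl
  ≈₄-reversal (at₆ refl) = at₂ refl
  ≈₄-reversal (at₇ refl) = at₁ refl

  ≈₄-induction : ∀ (P : Seq4 n → Set) → (∀ {s} → P s → P (shift s)) → (∀ {s} → P s → P (reversal s)) →
                 ∀ {s s′} → s ≈₄ s′ → P s → P s′
  ≈₄-induction P σ ρ (at₀ refl) p = p
  ≈₄-induction P σ ρ (at₁ refl) p = σ p
  ≈₄-induction P σ ρ (at₂ refl) p = σ (σ p)
  ≈₄-induction P σ ρ (at₃ refl) p = σ (σ (σ p))
  ≈₄-induction P σ ρ (at₄ refl) p = ρ p
  ≈₄-induction P σ ρ (at₅ refl) p = σ (ρ p)
  ≈₄-induction P σ ρ (at₆ refl) p = σ (σ (ρ p))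
  ≈₄-induction P σ ρ (at₇ refl) p = σ (σ (σ (ρ p)))

  ≈₄-trans : ∀ {s s′ s″ : Seq4 n} → s ≈₄ s′ → s′ ≈₄ s″ → s ≈₄ s″
  ≈₄-trans {s} p q = ≈₄-induction (s ≈₄_) ≈₄-shift ≈₄-reversal q p

  ≈₄-sym : ∀ {s s′ : Seq4 n} → s ≈₄ s′ → s′ ≈₄ s
  ≈₄-sym {s} p = ≈₄-induction (_≈₄ s) (≈₄-trans (at₃ refl)) (≈₄-trans (at₄ refl)) p ≈₄-refl

  ≈₄-decSetoid : DecSetoid _ _
  ≈₄-decSetoid = record
    { _≈_ = _≈₄_
    ; isDecEquivalence = record
      { isEquivalence = record { refl = ≈₄-refl ; sym = ≈₄-sym ; trans = ≈₄-trans }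
      ; _≟_ = _≈₄?_ } }

  Contains⇒≈₄ : ∀ {u v : Fin n} s → Contains u v s → ∃[ x ] ∃[ y ] s ≈₄ (u , v , x , y)
  Contains⇒≈₄ s (inj₁ (at₀ refl)) = _ , _ , at₀ refl
  Contains⇒≈₄ s (inj₁ (at₁ refl)) = _ , _ , at₁ refl
  Contains⇒≈₄ s (inj₁ (at₂ refl)) = _ , _ , at₂ refl
  Contains⇒≈₄ s (inj₁ (at₃ refl)) = _ , _ , at₃ refl
  Contains⇒≈₄ s (inj₂ (at₀ refl)) = _ , _ , at₆ refl
  Contains⇒≈₄ s (inj₂ (at₁ refl)) = _ , _ , at₅ refl
  Contains⇒≈₄ s (inj₂ (at₂ refl)) = _ , _ , at₄ refl
  Contains⇒≈₄ s (inj₂ (at₃ refl)) = _ , _ , at₇ refl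

  module _ (G : Graph n) where
    open Graph G

    IsC4-shift : ∀ {s} → IsC4 G s → IsC4 G (shift s)
    IsC4-shift (((xy ∷ xz ∷ xw ∷ []) ∷ (yz ∷ yw ∷ []) ∷ (zw ∷ []) ∷ [] ∷ []) , a , b , c , d) =
      ((yz ∷ yw ∷ ≢-sym xy ∷ []) ∷ (zw ∷ ≢-sym xz ∷ []) ∷ (≢-sym xw ∷ []) ∷ [] ∷ []) , b , c , d , a

    IsC4-reversal : ∀ {s} → IsC4 G s → IsC4 G (reversal s)
    IsC4-reversal (((xy ∷ xz ∷ xw ∷ []) ∷ (yz ∷ yw ∷ []) ∷ (zw ∷ []) ∷ [] ∷ []) , a , b , c , d) =
      ((≢-sym zw ∷ ≢-sym yw ∷ ≢-sym xw ∷ []) ∷ (≢-sym yz ∷ ≢-sym xz ∷ []) ∷ (≢-sym xy ∷ []) ∷ [] ∷ []) ,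
      symmetric c , symmetric b , symmetric a , symmetric d

    IsC4-≈₄ : ∀ {s s′} → s ≈₄ s′ → IsC4 G s → IsC4 G s′
    IsC4-≈₄ = ≈₄-induction (IsC4 G) IsC4-shift IsC4-reversal

    -- A 4-cycle through uv has exactly one of its eight sequences starting with u, v.
    ≈₄-start-injective : ∀ {u v x y x′ y′} → IsC4 G (u , v , x , y) →
                         (u , v , x , y) ≈₄ (u , v , x′ , y′) → (x , y) ≡ (x′ , y′)
    ≈₄-start-injective _ (at₀ refl) = refl
    ≈₄-start-injective (((uv ∷ _) ∷ _) , _) (at₁ refl) = contradiction refl uv
    ≈₄-start-injective (((_ ∷ ux ∷ _) ∷ _) , _) (at₂ refl) = contradiction refl ux
    ≈₄-start-injective (((_ ∷ _ ∷ uy ∷ _) ∷ _) , _) (at₃ refl) = contradiction refl uy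
    ≈₄-start-injective (((_ ∷ _ ∷ uy ∷ _) ∷ _) , _) (at₄ refl) = contradiction refl uy
    ≈₄-start-injective (((_ ∷ ux ∷ _) ∷ _) , _) (at₅ refl) = contradiction refl ux
    ≈₄-start-injective (((uv ∷ _) ∷ _) , _) (at₆ refl) = contradiction refl uv
    ≈₄-start-injective ((_ ∷ (_ ∷ vy ∷ _) ∷ _) , _) (at₇ refl) = contradiction refl vy

    □-∑ : ∀ u v → □ G u v ≡ ∑ (allFin n) λ x → ∑ (allFin n) λ y → 𝟙 (isC4? G (u , v , x , y))
    □-∑ u v = trans (≤-antisym □≤ ≤□) length-starts
      where
      P? = λ s → isC4? G s ×-dec contains? u v s
      cycles = filter P? (allSeq4 G)
      start? = λ (p : Fin n × Fin n) → isC4? G (u , v , p)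
      pairs = cartesianProduct (allFin n) (allFin n)
      starts = filter start? pairs

      ∈-all : ∀ s → s ∈ allSeq4 G
      ∈-all (x , y , z , w) = ∈-cartesianProduct⁺ (∈-allFin x)
        (∈-cartesianProduct⁺ (∈-allFin y) (∈-cartesianProduct⁺ (∈-allFin z) (∈-allFin w)))

      □≤ : □ G u v ≤ length starts
      □≤ = length-≤-injective _≈₄_ (λ s p → s ≈₄ (u , v , p)) (λ p q → ≈₄-trans p (≈₄-sym q))
        (UniqueDecSetoid.deduplicate-! ≈₄-decSetoid cycles)
        λ s∈ → let _ , c4 , c = ∈-filter⁻ P? {xs = allSeq4 G} (∈-deduplicate⁻ _≈₄?_ cycles s∈)
                   x , y , s≈ = Contains⇒≈₄ _ c
               in (x , y) , ∈-filter⁺ start? (∈-cartesianProduct⁺ (∈-allFin x) (∈-allFin y)) (IsC4-≈₄ s≈ c4) , s≈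

      ≤□ : length starts ≤ □ G u v
      ≤□ = length-≤-injective _≡_ (λ p s → IsC4 G (u , v , p) × s ≈₄ (u , v , p))
        (λ (c , p) (_ , q) → ≈₄-start-injective c (≈₄-trans (≈₄-sym p) q))
        (filter⁺ start? (cartesianProduct⁺ (allFin⁺ n) (allFin⁺ n)))
        λ {p} p∈ → let _ , c4 = ∈-filter⁻ start? {xs = pairs} p∈
                       any = Anyₚ.deduplicate⁺ _≈₄?_ {P = _≈₄ (u , v , p)} (λ b≈a → ≈₄-trans b≈a)
                               (Any.map (λ { refl → ≈₄-refl })
                                 (∈-filter⁺ P? (∈-all (u , v , p)) (c4 , inj₁ (at₀ refl))))
                       s , s∈ , s≈ = find any
                   in s , s∈ , c4 , s≈

      length-starts : length starts ≡ _
      length-starts = begin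
        length starts                                              ≡⟨ length-∑ starts ⟩
        ∑ starts (λ _ → 1)                                         ≡⟨ ∑-filter start? (λ _ → 1) pairs ⟩
        ∑ pairs (λ p → 𝟙 (start? p) * 1)                           ≡⟨ ∑-cong (λ p → *-identityʳ _) pairs ⟩
        ∑ pairs (λ p → 𝟙 (start? p))
          ≡⟨ ∑-cartesianProduct (𝟙 ∘ start?) (allFin n) (allFin n) ⟩
        ∑ (allFin n) (λ x → ∑ (allFin n) λ y → 𝟙 (start? (x , y))) ∎
        where open ≡-Reasoning

-- Counting by the ◁-largest vertex

module Counting {n : ℕ} (G : Graph n) (L : AdjacencyLists G) where
  open Graph G
  open AdjacencyLists L

  private
    V = allFin n
    d = degree G

  infix 4 _◁_ _◁?_

  _◁_ : Fin n → Fin n → Set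
  u ◁ v = d u < d v ⊎ (d u ≡ d v × toℕ u < toℕ v)

  _◁?_ : ∀ u v → Dec (u ◁ v)
  u ◁? v = (d u <? d v) ⊎-dec ((d u ℕ.≟ d v) ×-dec (toℕ u <? toℕ v))

  ◁-trans : ∀ {u v w} → u ◁ v → v ◁ w → u ◁ w
  ◁-trans (inj₁ p)       (inj₁ q)       = inj₁ (<-trans p q)
  ◁-trans (inj₁ p)       (inj₂ (e , _)) = inj₁ (<-≤-trans p (≤-reflexive e))
  ◁-trans (inj₂ (e , _)) (inj₁ q)       = inj₁ (≤-<-trans (≤-reflexive e) q)
  ◁-trans (inj₂ (e , p)) (inj₂ (f , q)) = inj₂ (trans e f , <-trans p q)

  ◁-irrefl : ∀ {u} → ¬ (u ◁ u)
  ◁-irrefl (inj₁ p)       = <-irrefl refl p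
  ◁-irrefl (inj₂ (_ , p)) = <-irrefl refl p

  ◁-asym : ∀ {u v} → u ◁ v → ¬ (v ◁ u)
  ◁-asym p q = ◁-irrefl (◁-trans p q)

  ◁⇒≢ : ∀ {u v} → u ◁ v → u ≢ v
  ◁⇒≢ p refl = ◁-irrefl p

  ◁-total : ∀ {u v} → u ≢ v → u ◁ v ⊎ v ◁ u
  ◁-total {u} {v} u≢v with <-cmp (d u) (d v)
  ... | tri< p _ _ = inj₁ (inj₁ p)
  ... | tri> _ _ p = inj₂ (inj₁ p)
  ... | tri≈ _ e _ with <-cmp (toℕ u) (toℕ v)
  ...   | tri< p _ _ = inj₁ (inj₂ (e , p))
  ...   | tri≈ _ q _ = contradiction (toℕ-injective q) u≢v
  ...   | tri> _ _ p = inj₂ (inj₂ (sym e , p))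

  ◁⇒degree-≤ : ∀ {u v} → u ◁ v → d u ≤ d v
  ◁⇒degree-≤ (inj₁ p)       = <⇒≤ p
  ◁⇒degree-≤ (inj₂ (e , _)) = ≤-reflexive e

  ∈-nbrs⇒Adj : ∀ {v u} → u ∈ nbrs v → Adj v u
  ∈-nbrs⇒Adj {v} u∈ = proj₂ (∈-filter⁻ (adj? v) {xs = V} (↭ₚ.∈-resp-↭ (nbrs-↭ v) u∈))

  Adj⇒∈-nbrs : ∀ {v u} → Adj v u → u ∈ nbrs v
  Adj⇒∈-nbrs {v} {u} a = ↭ₚ.∈-resp-↭ (↭-sym (nbrs-↭ v)) (∈-filter⁺ (adj? v) (∈-allFin u) a)

  length-nbrs : ∀ v → length (nbrs v) ≡ d v
  length-nbrs v = ↭ₚ.↭-length (nbrs-↭ v)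

  ∑-nbrs : ∀ v f → ∑ (nbrs v) f ≡ ∑ V λ u → 𝟙 (adj? v u) * f u
  ∑-nbrs v f = trans (∑-↭ f (nbrs-↭ v)) (∑-filter (adj? v) f V)

  spokes : Fin n → Fin n → List (Fin n × Fin n)
  spokes v u with u ◁? v
  ... | yes _ = map (u ,_) (nbrs u)
  ... | no _  = []

  wedges : Fin n → List (Fin n × Fin n)
  wedges v = concatMap (spokes v) (nbrs v)

  Wedge : Fin n → Fin n → Fin n → Set
  Wedge v u w = Adj v u × u ◁ v × Adj u w

  wedge? : ∀ v u w → Dec (Wedge v u w)
  wedge? v u w = adj? v u ×-dec (u ◁? v) ×-dec adj? u w

  ∑-spokes : ∀ v u f → ∑ (spokes v u) f ≡ 𝟙 (u ◁? v) * ∑ V λ w → 𝟙 (adj? u w) * f (u , w)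
  ∑-spokes v u f with u ◁? v
  ... | yes _ = trans (∑-map (u ,_) f (nbrs u)) (trans (∑-nbrs u _) (sym (*-identityˡ _)))
  ... | no _  = refl

  ∑-wedges : ∀ v f → ∑ (wedges v) f ≡ ∑ V λ u → ∑ V λ w → 𝟙 (wedge? v u w) * f (u , w)
  ∑-wedges v f = begin
    ∑ (wedges v) f
      ≡⟨ ∑-concatMap (spokes v) f (nbrs v) ⟩
    ∑ (nbrs v) (λ u → ∑ (spokes v u) f)                                 ≡⟨ ∑-nbrs v _ ⟩
    ∑ V (λ u → 𝟙 (adj? v u) * ∑ (spokes v u) f)                         ≡⟨ ∑-cong step V ⟩
    ∑ V (λ u → ∑ V λ w → 𝟙 (wedge? v u w) * f (u , w))                  ∎
    where
    open ≡-Reasoning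
    step : ∀ u → 𝟙 (adj? v u) * ∑ (spokes v u) f ≡ ∑ V λ w → 𝟙 (wedge? v u w) * f (u , w)
    step u = begin
      𝟙 (adj? v u) * ∑ (spokes v u) f
        ≡⟨ cong (𝟙 (adj? v u) *_) (∑-spokes v u f) ⟩
      𝟙 (adj? v u) * (𝟙 (u ◁? v) * ∑ V (λ w → 𝟙 (adj? u w) * f (u , w)))    ≡⟨ *-assoc (𝟙 (adj? v u)) _ _ ⟨
      𝟙 (adj? v u) * 𝟙 (u ◁? v) * ∑ V (λ w → 𝟙 (adj? u w) * f (u , w))      ≡⟨ ∑-*ˡ (𝟙 (adj? v u) * 𝟙 (u ◁? v)) _ V ⟨
      ∑ V (λ w → 𝟙 (adj? v u) * 𝟙 (u ◁? v) * (𝟙 (adj? u w) * f (u , w)))    ≡⟨ ∑-cong (λ w →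
        trans (sym (*-assoc (𝟙 (adj? v u) * 𝟙 (u ◁? v)) _ _)) (cong (_* f (u , w))
          (trans (*-assoc (𝟙 (adj? v u)) _ _) (sym (trans (𝟙-× (adj? v u) ((u ◁? v) ×-dec adj? u w)) (cong (𝟙 (adj? v u) *_) (𝟙-× (u ◁? v) (adj? u w)))))))) V ⟩
      ∑ V (λ w → 𝟙 (wedge? v u w) * f (u , w))                              ∎

  codegree : Fin n → Fin n → ℕ
  codegree v w = ∑ (wedges v) λ (_ , w′) → 𝟙 (w ≟ w′)

  codegree-∑ : ∀ v w → codegree v w ≡ ∑ V λ u → 𝟙 (wedge? v u w)
  codegree-∑ v w = trans (∑-wedges v _) (∑-cong (λ u → trans
    (∑-δ (λ w′ → 𝟙 (wedge? v u w′) * 𝟙 (w ≟ w′)) (allFin⁺ n) (∈-allFin w)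
      (λ {w′} w′≢w → trans (cong (𝟙 (wedge? v u w′) *_) (𝟙-no (w ≟ w′) (≢-sym w′≢w))) (*-zeroʳ (𝟙 (wedge? v u w′)))))
    (trans (cong (𝟙 (wedge? v u w) *_) (𝟙-yes (w ≟ w) refl)) (*-identityʳ _))) V)

  -- The 4-cycles v u w x in which v is the ◁-largest vertex.
  Top : Fin n → Fin n → Fin n → Fin n → Set
  Top v u w x = Wedge v u w × w ◁ v × Wedge v x w × x ≢ u

  top? : ∀ v u w x → Dec (Top v u w x)
  top? v u w x = wedge? v u w ×-dec (w ◁? v) ×-dec wedge? v x w ×-dec ¬? (x ≟ u)

  codegree∸1 : ∀ {v u w} → Wedge v u w → codegree v w ∸ 1 ≡ ∑ V λ x → 𝟙 (wedge? v x w ×-dec ¬? (x ≟ u))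
  codegree∸1 {v} {u} {w} wdg = trans (cong (_∸ 1) (begin
    codegree v w                                                              ≡⟨ codegree-∑ v w ⟩
    ∑ V (λ x → 𝟙 (wedge? v x w))                                              ≡⟨ ∑-cong split V ⟩
    ∑ V (λ x → 𝟙 (x ≟ u) + 𝟙 (wedge? v x w ×-dec ¬? (x ≟ u)))                 ≡⟨ ∑-+ (λ x → 𝟙 (x ≟ u)) _ V ⟩
    ∑ V (λ x → 𝟙 (x ≟ u)) + ∑ V (λ x → 𝟙 (wedge? v x w ×-dec ¬? (x ≟ u)))     ≡⟨ cong (_+ ∑ V (λ x → 𝟙 (wedge? v x w ×-dec ¬? (x ≟ u))))
      (trans (∑-δ (λ x → 𝟙 (x ≟ u)) (allFin⁺ n) (∈-allFin u) (λ {x} → 𝟙-no (x ≟ u))) (𝟙-yes (u ≟ u) refl)) ⟩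
    1 + ∑ V (λ x → 𝟙 (wedge? v x w ×-dec ¬? (x ≟ u)))                         ∎)) refl
    where
    open ≡-Reasoning
    split : ∀ x → 𝟙 (wedge? v x w) ≡ 𝟙 (x ≟ u) + 𝟙 (wedge? v x w ×-dec ¬? (x ≟ u))
    split x = trans
      (𝟙-cong (wedge? v x w) ((x ≟ u) ⊎-dec (wedge? v x w ×-dec ¬? (x ≟ u)))
        (λ p → [ inj₁ , (λ x≢u → inj₂ (p , x≢u)) ]′ (toSum (x ≟ u)))
        λ { (inj₁ refl) → wdg ; (inj₂ (p , _)) → p })
      (𝟙-⊎ (x ≟ u) (wedge? v x w ×-dec ¬? (x ≟ u)) λ (x≡u , _ , x≢u) → x≢u x≡u)

  score : Fin n → Fin n → ℕ
  score v w = 𝟙 (w ◁? v) * (codegree v w ∸ 1)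

  wedge-score : ∀ v u w → 𝟙 (wedge? v u w) * score v w ≡ ∑ V λ x → 𝟙 (top? v u w x)
  wedge-score v u w with wedge? v u w in eq
  ... | no ¬p = sym (∑-zero V)
  ... | yes p = begin
    1 * (𝟙 (w ◁? v) * (codegree v w ∸ 1))                                ≡⟨ *-identityˡ _ ⟩
    𝟙 (w ◁? v) * (codegree v w ∸ 1)
      ≡⟨ cong (𝟙 (w ◁? v) *_) (codegree∸1 p) ⟩
    𝟙 (w ◁? v) * ∑ V (λ x → 𝟙 (wedge? v x w ×-dec ¬? (x ≟ u)))           ≡⟨ ∑-*ˡ (𝟙 (w ◁? v)) _ V ⟨
    ∑ V (λ x → 𝟙 (w ◁? v) * 𝟙 (wedge? v x w ×-dec ¬? (x ≟ u)))           ≡⟨ ∑-cong (λ x → trans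
        (sym (𝟙-× (w ◁? v) (wedge? v x w ×-dec ¬? (x ≟ u))))
        (𝟙-cong _ (yes p ×-dec ((w ◁? v) ×-dec wedge? v x w ×-dec ¬? (x ≟ u))) (p ,_) proj₂)) V ⟩
    ∑ V (λ x → 𝟙 (yes p ×-dec ((w ◁? v) ×-dec wedge? v x w ×-dec ¬? (x ≟ u)))) ∎
    where open ≡-Reasoning

  _≟₂_ : (p q : Fin n × Fin n) → Dec (p ≡ q)
  _≟₂_ = ≡-dec _≟_ _≟_

  gain : Fin n → Fin n × Fin n → Fin n × Fin n → ℕ
  gain v p (u , w) = score v w * (𝟙 (p ≟₂ (v , u)) + 𝟙 (p ≟₂ (u , w)))

  gains : Fin n → Fin n × Fin n → ℕ
  gains v p = ∑ (wedges v) (gain v p)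

  tops : Fin n → Fin n → Fin n → ℕ
  tops v u w = ∑ V λ x → 𝟙 (top? v u w x)

  gains-∑ : ∀ v p → gains v p ≡ (∑ V λ u → ∑ V λ w → tops v u w * 𝟙 (p ≟₂ (v , u)))
                               + (∑ V λ u → ∑ V λ w → tops v u w * 𝟙 (p ≟₂ (u , w)))
  gains-∑ v p = begin
    gains v p                                                     ≡⟨ ∑-wedges v (gain v p) ⟩
    ∑ V (λ u → ∑ V λ w → 𝟙 (wedge? v u w) * gain v p (u , w))     ≡⟨ ∑-cong (λ u → ∑-cong (step u) V) V ⟩
    ∑ V (λ u → ∑ V λ w → f u w + g u w)                           ≡⟨ ∑-cong (λ u → ∑-+ (f u) (g u) V) V ⟩
    ∑ V (λ u → ∑ V (f u) + ∑ V (g u))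
      ≡⟨ ∑-+ (λ u → ∑ V (f u)) (λ u → ∑ V (g u)) V ⟩
    ∑ V (λ u → ∑ V (f u)) + ∑ V (λ u → ∑ V (g u))                 ∎
    where
    open ≡-Reasoning
    f = λ u w → tops v u w * 𝟙 (p ≟₂ (v , u))
    g = λ u w → tops v u w * 𝟙 (p ≟₂ (u , w))
    step : ∀ u w → 𝟙 (wedge? v u w) * gain v p (u , w) ≡ f u w + g u w
    step u w = trans (sym (*-assoc (𝟙 (wedge? v u w)) (score v w) _))
      (trans (cong (_* (𝟙 (p ≟₂ (v , u)) + 𝟙 (p ≟₂ (u , w)))) (wedge-score v u w))
             (*-distribˡ-+ (tops v u w) (𝟙 (p ≟₂ (v , u))) (𝟙 (p ≟₂ (u , w)))))

  ∑-δ₂ : ∀ a b (f : Fin n → Fin n → ℕ) → (∀ {x y} → (a , b) ≢ (x , y) → f x y ≡ 0) →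
         (∑ V λ x → ∑ V λ y → f x y) ≡ f a b
  ∑-δ₂ a b f z = trans
    (∑-δ (λ x → ∑ V (f x)) (allFin⁺ n) (∈-allFin a)
      (λ x≢a → trans (∑-cong (λ y → z (λ { refl → x≢a refl })) V) (∑-zero V)))
    (∑-δ (f a) (allFin⁺ n) (∈-allFin b) (λ y≢b → z (λ { refl → y≢b refl })))

  total : Fin n × Fin n → ℕ
  total p = ∑ V λ v → gains v p

  total-∑ : ∀ a b → total (a , b) ≡ (∑ V λ x → ∑ V λ y → 𝟙 (top? a b x y)) + (∑ V λ y → ∑ V λ x → 𝟙 (top? y a b x))
  total-∑ a b = begin
    total (a , b)                                   ≡⟨ ∑-cong (λ v → gains-∑ v (a , b)) V ⟩
    ∑ V (λ v → F v + H v)                           ≡⟨ ∑-+ F H V ⟩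
    ∑ V F + ∑ V H                                   ≡⟨ cong₂ _+_ first (∑-cong second V) ⟩
    ∑ V (λ w → tops a b w) + ∑ V (λ v → tops v a b) ∎
    where
    open ≡-Reasoning
    F = λ v → ∑ V λ u → ∑ V λ w → tops v u w * 𝟙 ((a , b) ≟₂ (v , u))
    H = λ v → ∑ V λ u → ∑ V λ w → tops v u w * 𝟙 ((a , b) ≟₂ (u , w))
    off : ∀ k {q} → (a , b) ≢ q → k * 𝟙 ((a , b) ≟₂ q) ≡ 0
    off k {q} ne = trans (cong (k *_) (𝟙-no ((a , b) ≟₂ q) ne)) (*-zeroʳ k)
    on : ∀ k → k * 𝟙 ((a , b) ≟₂ (a , b)) ≡ k
    on k = trans (cong (k *_) (𝟙-yes ((a , b) ≟₂ (a , b)) refl)) (*-identityʳ k)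
    first : ∑ V F ≡ ∑ V (λ w → tops a b w)
    first = trans
      (∑-δ₂ a b (λ v u → ∑ V λ w → tops v u w * 𝟙 ((a , b) ≟₂ (v , u)))
        (λ {v} {u} ne → trans (∑-cong (λ w → off (tops v u w) ne) V) (∑-zero V)))
      (∑-cong (λ w → on (tops a b w)) V)
    second : ∀ v → H v ≡ tops v a b
    second v = trans
      (∑-δ₂ a b (λ u w → tops v u w * 𝟙 ((a , b) ≟₂ (u , w))) (λ {u} {w} → off (tops v u w)))
      (on (tops v a b))

  Top⇒ : ∀ {v u w x} → Top v u w x → IsC4 G (v , u , w , x) × u ◁ v × w ◁ v × x ◁ v
  Top⇒ ((vu , u◁v , uw) , w◁v , (vx , x◁v , xw) , x≢u) =
    (((≢-sym (◁⇒≢ u◁v) ∷ ≢-sym (◁⇒≢ w◁v) ∷ ≢-sym (◁⇒≢ x◁v) ∷ []) ∷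
      ((λ e → irreflexive e uw) ∷ ≢-sym x≢u ∷ []) ∷ ((λ e → irreflexive (sym e) xw) ∷ []) ∷ [] ∷ []) ,
     vu , uw , symmetric xw , symmetric vx) , u◁v , w◁v , x◁v

  ⇒Top : ∀ {v u w x} → IsC4 G (v , u , w , x) → u ◁ v → w ◁ v → x ◁ v → Top v u w x
  ⇒Top ((_ ∷ (_ ∷ u≢x ∷ []) ∷ _) , vu , uw , wx , xv) u◁v w◁v x◁v =
    (vu , u◁v , uw) , w◁v , (symmetric xv , x◁v , symmetric wx) , ≢-sym u≢x

  𝟙-C4 : ∀ a b x y → 𝟙 (isC4? G (a , b , x , y)) ≡
         (𝟙 (top? a b x y) + 𝟙 (top? y a b x)) + (𝟙 (top? b a y x) + 𝟙 (top? x b a y))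
  𝟙-C4 a b x y = begin
    𝟙 (isC4? G (a , b , x , y))
      ≡⟨ 𝟙-cong (isC4? G (a , b , x , y)) (ta ⊎-dec ty ⊎-dec tb ⊎-dec tx) max back ⟩
    𝟙 (ta ⊎-dec ty ⊎-dec tb ⊎-dec tx) ≡⟨ 𝟙-⊎ ta (ty ⊎-dec tb ⊎-dec tx) (λ (p , q) → ¬a p q) ⟩
    𝟙 ta + 𝟙 (ty ⊎-dec tb ⊎-dec tx)   ≡⟨ cong (𝟙 ta +_) (𝟙-⊎ ty (tb ⊎-dec tx) (λ (p , q) → ¬y p q)) ⟩
    𝟙 ta + (𝟙 ty + 𝟙 (tb ⊎-dec tx))   ≡⟨ cong (λ k → 𝟙 ta + (𝟙 ty + k)) (𝟙-⊎ tb tx (λ (p , q) → ¬b p q)) ⟩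
    𝟙 ta + (𝟙 ty + (𝟙 tb + 𝟙 tx))     ≡⟨ +-assoc (𝟙 ta) (𝟙 ty) _ ⟨
    (𝟙 ta + 𝟙 ty) + (𝟙 tb + 𝟙 tx)     ∎
    where
    open ≡-Reasoning
    ta = top? a b x y
    ty = top? y a b x
    tb = top? b a y x
    tx = top? x b a y
    ¬a : Top a b x y → ¬ (Top y a b x ⊎ Top b a y x ⊎ Top x b a y)
    ¬a p with Top⇒ p
    ... | _ , b◁a , x◁a , y◁a = λ
      { (inj₁ q) → ◁-asym y◁a (proj₁ (proj₂ (Top⇒ q)))
      ; (inj₂ (inj₁ q)) → ◁-asym b◁a (proj₁ (proj₂ (Top⇒ q)))
      ; (inj₂ (inj₂ q)) → ◁-asym x◁a (proj₁ (proj₂ (proj₂ (Top⇒ q)))) }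
    ¬y : Top y a b x → ¬ (Top b a y x ⊎ Top x b a y)
    ¬y p with Top⇒ p
    ... | _ , a◁y , b◁y , x◁y = λ
      { (inj₁ q) → ◁-asym b◁y (proj₁ (proj₂ (proj₂ (Top⇒ q))))
      ; (inj₂ q) → ◁-asym x◁y (proj₂ (proj₂ (proj₂ (Top⇒ q)))) }
    ¬b : Top b a y x → ¬ Top x b a y
    ¬b p q = ◁-asym (proj₂ (proj₂ (proj₂ (Top⇒ p)))) (proj₁ (proj₂ (Top⇒ q)))
    back : Top a b x y ⊎ Top y a b x ⊎ Top b a y x ⊎ Top x b a y → IsC4 G (a , b , x , y)
    back (inj₁ p)               = proj₁ (Top⇒ p)
    back (inj₂ (inj₁ p))        = IsC4-shift G (proj₁ (Top⇒ p))
    back (inj₂ (inj₂ (inj₁ p))) = IsC4-shift G (IsC4-shift G (IsC4-reversal G (proj₁ (Top⇒ p))))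
    back (inj₂ (inj₂ (inj₂ p))) = IsC4-shift G (IsC4-reversal G (proj₁ (Top⇒ p)))
    max : IsC4 G (a , b , x , y) → Top a b x y ⊎ Top y a b x ⊎ Top b a y x ⊎ Top x b a y
    max c@(((ab ∷ ax ∷ ay ∷ []) ∷ (bx ∷ by ∷ []) ∷ (xy ∷ []) ∷ [] ∷ []) , _)
      with ◁-total ab | ◁-total xy
    max c@(((ab ∷ ax ∷ ay ∷ []) ∷ (bx ∷ by ∷ []) ∷ (xy ∷ []) ∷ [] ∷ []) , _) | inj₁ a◁b | inj₁ x◁y with ◁-total by
    ... | inj₁ b◁y = inj₂ (inj₁ (⇒Top (IsC4-shift G (IsC4-shift G (IsC4-shift G c))) (◁-trans a◁b b◁y) b◁y x◁y))
    ... | inj₂ y◁b =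
      inj₂ (inj₂ (inj₁ (⇒Top (IsC4-reversal G (IsC4-shift G (IsC4-shift G c))) a◁b y◁b (◁-trans x◁y y◁b))))
    max c@(((ab ∷ ax ∷ ay ∷ []) ∷ (bx ∷ by ∷ []) ∷ (xy ∷ []) ∷ [] ∷ []) , _) | inj₁ a◁b | inj₂ y◁x with ◁-total bx
    ... | inj₁ b◁x =
      inj₂ (inj₂ (inj₂ (⇒Top (IsC4-reversal G (IsC4-shift G (IsC4-shift G (IsC4-shift G c)))) b◁x (◁-trans a◁b b◁x) y◁x)))
    ... | inj₂ x◁b =
      inj₂ (inj₂ (inj₁ (⇒Top (IsC4-reversal G (IsC4-shift G (IsC4-shift G c))) a◁b (◁-trans y◁x x◁b) x◁b)))
    max c@(((ab ∷ ax ∷ ay ∷ []) ∷ (bx ∷ by ∷ []) ∷ (xy ∷ []) ∷ [] ∷ []) , _) | inj₂ b◁a | inj₁ x◁y with ◁-total ay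
    ... | inj₁ a◁y = inj₂ (inj₁ (⇒Top (IsC4-shift G (IsC4-shift G (IsC4-shift G c))) a◁y (◁-trans b◁a a◁y) x◁y))
    ... | inj₂ y◁a = inj₁ (⇒Top c b◁a (◁-trans x◁y y◁a) y◁a)
    max c@(((ab ∷ ax ∷ ay ∷ []) ∷ (bx ∷ by ∷ []) ∷ (xy ∷ []) ∷ [] ∷ []) , _) | inj₂ b◁a | inj₂ y◁x with ◁-total ax
    ... | inj₁ a◁x =
      inj₂ (inj₂ (inj₂ (⇒Top (IsC4-reversal G (IsC4-shift G (IsC4-shift G (IsC4-shift G c)))) (◁-trans b◁a a◁x) a◁x y◁x)))
    ... | inj₂ x◁a = inj₁ (⇒Top c b◁a x◁a (◁-trans y◁x x◁a))

  total-□ : ∀ a b → total (a , b) + total (b , a) ≡ □ G a b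
  total-□ a b = begin
    total (a , b) + total (b , a)                   ≡⟨ cong₂ _+_ (total-∑ a b) (total-∑ b a) ⟩
    (∑₂ α + ∑₂ (λ y x → 𝟙 (top? y a b x))) + (∑₂ (λ y x → 𝟙 (top? b a y x)) + ∑₂ δ)
      ≡⟨ cong₂ (λ i j → (∑₂ α + i) + (j + ∑₂ δ)) (∑-swap _ V V) (∑-swap _ V V) ⟩
    (∑₂ α + ∑₂ β) + (∑₂ γ + ∑₂ δ)                   ≡⟨ cong₂ _+_ (∑₂-+ α β) (∑₂-+ γ δ) ⟨
    ∑₂ (λ x y → α x y + β x y) + ∑₂ (λ x y → γ x y + δ x y) ≡⟨ ∑₂-+ _ _ ⟨
    ∑₂ (λ x y → (α x y + β x y) + (γ x y + δ x y))  ≡⟨ ∑-cong (λ x → ∑-cong (λ y → 𝟙-C4 a b x y) V) V ⟨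
    ∑₂ (λ x y → 𝟙 (isC4? G (a , b , x , y)))        ≡⟨ □-∑ G a b ⟨
    □ G a b                                         ∎
    where
    open ≡-Reasoning
    ∑₂ : (Fin n → Fin n → ℕ) → ℕ
    ∑₂ f = ∑ V λ x → ∑ V (f x)
    ∑₂-+ : ∀ f g → ∑₂ (λ x y → f x y + g x y) ≡ ∑₂ f + ∑₂ g
    ∑₂-+ f g = trans (∑-cong (λ x → ∑-+ (f x) (g x) V) V) (∑-+ (λ x → ∑ V (f x)) _ V)
    α = λ x y → 𝟙 (top? a b x y)
    β = λ x y → 𝟙 (top? y a b x)
    γ = λ x y → 𝟙 (top? b a y x)
    δ = λ x y → 𝟙 (top? x b a y)

  ∑-darts : ∀ (f : Fin n → Fin n → ℕ) →
            (∑ V λ v → ∑ (nbrs v) (f v)) ≡ ∑ (edges G) λ (u , v) → f u v + f v u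
  ∑-darts f = begin
    ∑ V (λ v → ∑ (nbrs v) (f v))                              ≡⟨ ∑-cong (λ v → ∑-nbrs v (f v)) V ⟩
    ∑ V (λ v → ∑ V λ u → 𝟙 (adj? v u) * f v u)                ≡⟨ ∑-cong (λ v → ∑-cong (split v) V) V ⟩
    ∑ V (λ v → ∑ V λ u → E v u * f v u + E u v * f v u)       ≡⟨ ∑-cong (λ v → ∑-+ _ _ V) V ⟩
    ∑ V (λ v → ∑ V (λ u → E v u * f v u) + ∑ V (λ u → E u v * f v u)) ≡⟨ ∑-+ _ _ V ⟩
    ∑ V (λ v → ∑ V (λ u → E v u * f v u)) + ∑ V (λ v → ∑ V (λ u → E u v * f v u))
      ≡⟨ cong (∑ V (λ v → ∑ V (λ u → E v u * f v u)) +_) (∑-swap _ V V) ⟩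
    ∑ V (λ u → ∑ V (λ v → E u v * f u v)) + ∑ V (λ u → ∑ V (λ v → E u v * f v u)) ≡⟨ ∑-+ _ _ V ⟨
    ∑ V (λ u → ∑ V (λ v → E u v * f u v) + ∑ V (λ v → E u v * f v u)) ≡⟨ ∑-cong (λ u → trans (sym (∑-+ _ _ V))
                                                                          (∑-cong (λ v → sym (*-distribˡ-+ (E u v) (f u v) (f v u))) V)) V ⟩
    ∑ V (λ u → ∑ V (λ v → E u v * (f u v + f v u)))           ≡⟨ ∑-cartesianProduct _ V V ⟨
    ∑ (cartesianProduct V V) (λ (u , v) → E u v * (f u v + f v u)) ≡⟨ ∑-filter (λ (u , v) → (u Finₚ.<? v) ×-dec adj? u v) _ (cartesianProduct V V) ⟨
    ∑ (edges G) (λ (u , v) → f u v + f v u)                   ∎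
    where
    open ≡-Reasoning
    e? = λ u v → (u Finₚ.<? v) ×-dec adj? u v
    E = λ u v → 𝟙 (e? u v)
    split : ∀ v u → 𝟙 (adj? v u) * f v u ≡ E v u * f v u + E u v * f v u
    split v u = trans (cong (_* f v u) (trans
      (𝟙-cong (adj? v u) (e? v u ⊎-dec e? u v) to λ { (inj₁ (_ , a)) → a ; (inj₂ (_ , a)) → symmetric a })
      (𝟙-⊎ (e? v u) (e? u v) λ ((p , _) , (q , _)) → <-asym p q))) (*-distribʳ-+ (f v u) (E v u) (E u v))
      where
      to : Adj v u → _
      to a with <-cmp (toℕ v) (toℕ u)
      ... | tri< p _ _ = inj₁ (p , a)
      ... | tri≈ _ e _ = contradiction a (irreflexive (toℕ-injective e))
      ... | tri> _ _ p = inj₂ (p , symmetric a)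

-- Arrays and a program logic with time bounds

private variable
  k : ℕ

-- The junk value 0 outside the array is never read by a run.
get : Vec ℕ k → ℕ → ℕ
get Vec.[]       _       = 0
get (x Vec.∷ xs) zero    = x
get (x Vec.∷ xs) (suc i) = get xs i

set : Vec ℕ k → ℕ → ℕ → Vec ℕ k
set Vec.[]       _       v = Vec.[]
set (x Vec.∷ xs) zero    v = v Vec.∷ xs
set (x Vec.∷ xs) (suc i) v = x Vec.∷ set xs i v

get-set-≡ : ∀ (A : Vec ℕ k) {i} v → i < k → get (set A i v) i ≡ v
get-set-≡ (x Vec.∷ A) {zero}  v _         = refl
get-set-≡ (x Vec.∷ A) {suc i} v (s≤s i<k) = get-set-≡ A v i<k

get-set-≢ : ∀ (A : Vec ℕ k) {i j} v → i ≢ j → get (set A i v) j ≡ get A j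
get-set-≢ Vec.[]      v _ = refl
get-set-≢ (x Vec.∷ A) {zero}  {zero}  v i≢j = contradiction refl i≢j
get-set-≢ (x Vec.∷ A) {zero}  {suc j} v i≢j = refl
get-set-≢ (x Vec.∷ A) {suc i} {zero}  v i≢j = refl
get-set-≢ (x Vec.∷ A) {suc i} {suc j} v i≢j = get-set-≢ A v (λ e → i≢j (cong suc e))

lookup-get : ∀ (A : Vec ℕ k) j → lookup A j ≡ get A (toℕ j)
lookup-get (x Vec.∷ A) Fin.zero    = refl
lookup-get (x Vec.∷ A) (Fin.suc j) = lookup-get A j

update-set : ∀ (A : Vec ℕ k) j v → A [ j ]≔ v ≡ set A (toℕ j) v
update-set (x Vec.∷ A) Fin.zero    v = refl
update-set (x Vec.∷ A) (Fin.suc j) v = cong (x Vec.∷_) (update-set A j v)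

take-toList : ∀ (xs : List ℕ) (A : Vec ℕ k) → length xs ≤ k →
              (∀ {i x} → xs [ i ]= x → get A i ≡ x) → take (length xs) (toList A) ≡ xs
take-toList []       A           _         _ = refl
take-toList (x ∷ xs) (y Vec.∷ A) (s≤s l≤k) f =
  cong₂ _∷_ (f here) (take-toList xs A l≤k (λ p → f (there p)))

module Logic {i r k : ℕ} (inputs : Vec (List ℕ) i) (S W : ℕ) where

  open Semantics {i} {r} {k} inputs S W

  Exec : Program i r k → State r k S → ℕ → (State r k S → Set) → Set
  Exec P s T Q = ∃[ t ] ∃[ s′ ] (Run P s t s′ × t ≤ T × Q s′)

  weaken : ∀ {P s T T′ Q Q′} → T ≤ T′ → (∀ {s′} → Q s′ → Q′ s′) → Exec P s T Q → Exec P s T′ Q′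
  weaken T≤T′ Q⊆Q′ (t , s′ , π , t≤T , q) = t , s′ , π , ≤-trans t≤T T≤T′ , Q⊆Q′ q

  weakenᵗ : ∀ {P s T T′ Q} → T ≤ T′ → Exec P s T Q → Exec P s T′ Q
  weakenᵗ T≤T′ = weaken T≤T′ (λ q → q)

  exec-skip : ∀ {s Q} → Q s → Exec skip s 1 Q
  exec-skip q = 1 , _ , skip , ≤-refl , q

  exec-seq : ∀ {P P′ s T T′ Q} → Exec P s T (λ s′ → Exec P′ s′ T′ Q) → Exec (P ⨾ P′) s (T + T′) Q
  exec-seq (_ , _ , π , t≤ , _ , _ , π′ , t′≤ , q) = _ , _ , seq π π′ , +-mono-≤ t≤ t′≤ , q

  exec-≔ : ∀ {ρ μ x e v Q} → ⟨ ρ , μ ⟩ ⊢ e ⇓ v → v < W → Q ⟨ ρ [ x ]≔ v , μ ⟩ →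
           Exec (x ≔ e) ⟨ ρ , μ ⟩ 1 Q
  exec-≔ e⇓v v<W q = 1 , _ , assign e⇓v v<W , ≤-refl , q

  exec-store : ∀ {ρ μ a x y Q} → lookup ρ x < S →
               Q ⟨ ρ , μ [ a ]≔ set (lookup μ a) (lookup ρ x) (lookup ρ y) ⟩ →
               Exec (a [ x ]≔ʷ y) ⟨ ρ , μ ⟩ 1 Q
  exec-store {ρ} {μ} {a} {x} {y} {Q} x<S q = 1 , _ , store j e , ≤-refl ,
    subst (λ A → Q ⟨ ρ , μ [ a ]≔ A ⟩)
          (sym (trans (update-set (lookup μ a) j (lookup ρ y)) (cong (λ i → set (lookup μ a) i (lookup ρ y)) e))) q
    where
    j = Fin.fromℕ< x<S
    e = toℕ-fromℕ< x<S

  exec-if : ∀ {b P P′ s T Q} → (Dec (Holds b (State.regs s))) →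
            (Holds b (State.regs s) → Exec P s T Q) → (¬ Holds b (State.regs s) → Exec P′ s T Q) →
            Exec (if b then P else P′) s (suc T) Q
  exec-if (yes h) f _ = let _ , _ , π , t≤ , q = f h in _ , _ , then′ h π , s≤s t≤ , q
  exec-if (no ¬h) _ g = let _ , _ , π , t≤ , q = g ¬h in _ , _ , else′ ¬h π , s≤s t≤ , q

  exec-stop : ∀ {b P s Q} → ¬ Holds b (State.regs s) → Q s → Exec (while b run P) s 1 Q
  exec-stop ¬h q = 1 , _ , stop ¬h , ≤-refl , q

  exec-loop : ∀ {b P s T T′ Q} → Holds b (State.regs s) →
              Exec P s T (λ s′ → Exec (while b run P) s′ T′ Q) → Exec (while b run P) s (suc (T + T′)) Q
  exec-loop h (_ , _ , π , t≤ , _ , _ , π′ , t′≤ , q) =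
    _ , _ , loop h π π′ , s≤s (+-mono-≤ t≤ t′≤) , q

  eval-input : ∀ {ρ μ a x v} → lookup inputs a [ lookup ρ x ]= v → ⟨ ρ , μ ⟩ ⊢ input a x ⇓ v
  eval-input {a = a} {x} p with []=⇒lookup p
  ... | j , e , refl = input j e

  eval-load : ∀ {ρ μ a x} → lookup ρ x < S → ⟨ ρ , μ ⟩ ⊢ load a x ⇓ get (lookup μ a) (lookup ρ x)
  eval-load {ρ} {μ} {a} {x} x<S =
    subst (⟨ ρ , μ ⟩ ⊢ load a x ⇓_) (trans (lookup-get (lookup μ a) j) (cong (get (lookup μ a)) e)) (load j e)
    where
    j = Fin.fromℕ< x<S
    e = toℕ-fromℕ< x<S

  eval-load-≡ : ∀ {ρ μ a x v} → lookup ρ x < S → get (lookup μ a) (lookup ρ x) ≡ v → ⟨ ρ , μ ⟩ ⊢ load a x ⇓ v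
  eval-load-≡ x<S refl = eval-load x<S

module Layout {n : ℕ} (G : Graph n) (L : AdjacencyLists G) where
  open Graph G
  open AdjacencyLists L
  open Counting G L public

  V = allFin n
  d = degree G
  m₂ = length (adjacencyArray L)

  cells : List (Fin n × Fin n)
  cells = concatMap (λ v → map (v ,_) (nbrs v)) V

  offset : Fin n → ℕ
  offset v = ∑ (take (toℕ v) V) d

  V-[]= : ∀ v → V [ toℕ v ]= v
  V-[]= = []=-tabulate id

  degreeArray-[]= : ∀ v → degreeArray L [ toℕ v ]= d v
  degreeArray-[]= v = []=-map d (V-[]= v)

  offsetArray-[]= : ∀ v → offsetArray L [ toℕ v ]= offset v
  offsetArray-[]= v = []=-map offset (V-[]= v)

  adjacencyArray-cells : adjacencyArray L ≡ map (toℕ ∘ proj₂) cells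
  adjacencyArray-cells = sym (trans (map-concatMap (toℕ ∘ proj₂) _ V)
                                    (concatMap-cong (λ v → sym (map-∘ (nbrs v))) V))

  edgeCounts-cells : edgeCounts L ≡ map (uncurry (□ G)) cells
  edgeCounts-cells = sym (trans (map-concatMap (uncurry (□ G)) _ V)
                                (concatMap-cong (λ v → sym (map-∘ (nbrs v))) V))

  length-cells : length cells ≡ m₂
  length-cells = sym (trans (cong length adjacencyArray-cells) (length-map (toℕ ∘ proj₂) cells))

  length-dart : ∀ v → length (map (v ,_) (nbrs v)) ≡ d v
  length-dart v = trans (length-map (v ,_) (nbrs v)) (length-nbrs v)

  m₂-∑ : m₂ ≡ ∑ V d
  m₂-∑ = trans (sym length-cells) (trans (length-concatMap _ V) (∑-cong length-dart V))

  cells-[]= : ∀ v {i u} → nbrs v [ i ]= u → cells [ offset v + i ]= (v , u)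
  cells-[]= v {i} {u} p = subst (λ c → cells [ c + i ]= (v , u)) (∑-cong length-dart (take (toℕ v) V))
    ([]=-concatMap (λ v → map (v ,_) (nbrs v)) (V-[]= v) ([]=-map (v ,_) p))

  adjacencyArray-[]= : ∀ {c a b} → cells [ c ]= (a , b) → adjacencyArray L [ c ]= toℕ b
  adjacencyArray-[]= {c} {_} {b} p =
    subst (_[ c ]= toℕ b) (sym adjacencyArray-cells) ([]=-map (toℕ ∘ proj₂) p)

  []=⇒<m₂ : ∀ {c p} → cells [ c ]= p → c < m₂
  []=⇒<m₂ p = subst (_ <_) length-cells ([]=⇒< p)

  unique-nbrs : ∀ v → Unique (nbrs v)
  unique-nbrs v =
    Unique-resp-↭ (setoid (Fin n)) (↭⇒↭ₛ (↭-sym (nbrs-↭ v))) (Uniqueₚ.filter⁺ (adj? v) (allFin⁺ n))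

  unique-cells : Unique cells
  unique-cells = Uniqueₚ.concat⁺
    (Allₚ.map⁺ (All.universal (λ v → Uniqueₚ.map⁺ (λ { refl → refl }) (unique-nbrs v)) V))
    (AllPairsₚ.map⁺ (AllPairs.map disjoint (allFin⁺ n)))
    where
    disjoint : ∀ {v v′} → v ≢ v′ → ∀ {p} → ¬ (p ∈ map (v ,_) (nbrs v) × p ∈ map (v′ ,_) (nbrs v′))
    disjoint v≢v′ (p , q) with ∈-map⁻ _ p | ∈-map⁻ _ q
    ... | _ , _ , refl | _ , _ , refl = v≢v′ refl

  cells-Adj : ∀ {c a b} → cells [ c ]= (a , b) → Adj a b
  cells-Adj p with find (∈-concatMap⁻ _ {xs = V} ([]=⇒∈ p))
  ... | _ , _ , q with ∈-map⁻ _ q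
  ... | _ , b∈ , refl = ∈-nbrs⇒Adj b∈

  Adj-cells : ∀ {a b} → Adj a b → ∃[ c ] cells [ c ]= (a , b)
  Adj-cells a = let _ , p = ∈⇒[]= (Adj⇒∈-nbrs a) in _ , cells-[]= _ p

  Live : Fin n → Set
  Live v = 0 < d v

  Adj⇒Live : ∀ {v u} → Adj v u → Live v
  Adj⇒Live {v} a = subst (0 <_) (length-nbrs v) (≤-trans (s≤s z≤n) ([]=⇒< (proj₂ (∈⇒[]= (Adj⇒∈-nbrs a)))))

  first-cell : ∀ {v} → Live v → ∃[ u ] cells [ offset v ]= (v , u)
  first-cell {v} l with nbrs v in eq
  ... | []     = contradiction (subst (0 <_) (trans (sym (length-nbrs v)) (cong length eq)) l) λ ()
  ... | u ∷ us = u , subst (λ c → cells [ c ]= (v , u)) (+-identityʳ (offset v))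
                       (cells-[]= v (subst (_[ 0 ]= u) (sym eq) here))

  offset-injective : ∀ {v w} → Live v → Live w → offset v ≡ offset w → v ≡ w
  offset-injective {v} {w} lv lw e = cong proj₁
    ([]=-functional (proj₂ (first-cell lv)) (subst (λ c → cells [ c ]= (w , proj₁ (first-cell lw))) (sym e) (proj₂ (first-cell lw))))

  offset+degree≤m₂ : ∀ v → offset v + d v ≤ m₂
  offset+degree≤m₂ v = subst (offset v + d v ≤_) (sym m₂-∑) (go (V-[]= v))
    where
    go : ∀ {xs i x} → xs [ i ]= x → ∑ (take i xs) d + d x ≤ ∑ xs d
    go here = m≤m+n _ _
    go (there {x} p) = ≤-trans (≤-reflexive (+-assoc (d x) _ _)) (+-monoʳ-≤ (d x) (go p))

  offset-split : ∀ vs {v rest} → V ≡ vs ++ v ∷ rest → offset v ≡ ∑ vs d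
  offset-split vs {v} {rest} e = cong (λ xs → ∑ xs d) (trans
    (cong (λ i → take i V) ([]=-injective (allFin⁺ n) (V-[]= v) ([]=-split vs e)))
    (trans (cong (take (length vs)) e) (take-++ vs)))
    where
    take-++ : ∀ xs → take (length xs) (xs ++ v ∷ rest) ≡ xs
    take-++ []       = refl
    take-++ (x ∷ xs) = cong (x ∷_) (take-++ xs)

  degree≤n : ∀ v → d v ≤ n
  degree≤n v = ≤-trans (length-filter (adj? v) V) (≤-reflexive (length-tabulate id))

  length-V : length V ≡ n
  length-V = length-tabulate id

  N = 2 + n
  W = N ^ 8

  n≤N : n ≤ N
  n≤N = m≤n+m n 2

  2≤N : 2 ≤ N
  2≤N = m≤m+n 2 n

  m₂≤N² : m₂ ≤ N ^ 2
  m₂≤N² = begin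
    m₂            ≡⟨ m₂-∑ ⟩
    ∑ V d         ≤⟨ ∑-≤ degree≤n V ⟩
    length V * n  ≡⟨ cong (_* n) length-V ⟩
    n * n         ≤⟨ *-mono-≤ n≤N n≤N ⟩
    N * N         ≡⟨ cong (N *_) (*-identityʳ N) ⟨
    N ^ 2         ∎
    where open ≤-Reasoning

  length-wedges : ∀ v → length (wedges v) ≤ N ^ 2
  length-wedges v = begin
    length (wedges v)                       ≡⟨ length-concatMap (spokes v) (nbrs v) ⟩
    ∑ (nbrs v) (λ u → length (spokes v u))  ≤⟨ ∑-≤ length-spokes (nbrs v) ⟩
    length (nbrs v) * n                     ≡⟨ cong (_* n) (length-nbrs v) ⟩
    d v * n                                 ≤⟨ *-mono-≤ (≤-trans (degree≤n v) n≤N) n≤N ⟩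
    N * N                                   ≡⟨ cong (N *_) (*-identityʳ N) ⟨
    N ^ 2                                   ∎
    where
    open ≤-Reasoning
    length-spokes : ∀ u → length (spokes v u) ≤ n
    length-spokes u with u ◁? v
    ... | yes _ = ≤-trans (≤-reflexive (trans (length-map (u ,_) (nbrs u)) (length-nbrs u))) (degree≤n u)
    ... | no _  = z≤n

  count : List (Fin n × Fin n) → Fin n → ℕ
  count es w = ∑ es λ (_ , w′) → 𝟙 (w ≟ w′)

  count≤length : ∀ es w → count es w ≤ length es
  count≤length es w = ≤-trans (∑-≤ (λ (_ , w′) → 𝟙≤1 (w ≟ w′)) es) (≤-reflexive (*-identityʳ (length es)))

  gain≤ : ∀ v p e → gain v p e ≤ N ^ 3
  gain≤ v p (u , w) = begin
    score v w * (𝟙 (p ≟₂ (v , u)) + 𝟙 (p ≟₂ (u , w)))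
      ≤⟨ *-mono-≤ (*-mono-≤ (𝟙≤1 (w ◁? v)) (≤-trans (m∸n≤m _ 1) (≤-trans (count≤length (wedges v) w) (length-wedges v))))
                  (+-mono-≤ (𝟙≤1 (p ≟₂ (v , u))) (𝟙≤1 (p ≟₂ (u , w)))) ⟩
    1 * N ^ 2 * 2  ≡⟨ cong (_* 2) (*-identityˡ (N ^ 2)) ⟩
    N ^ 2 * 2      ≤⟨ *-monoʳ-≤ (N ^ 2) 2≤N ⟩
    N ^ 2 * N      ≡⟨ *-comm (N ^ 2) N ⟩
    N ^ 3          ∎
    where open ≤-Reasoning

  total≤ : ∀ p → total p ≤ N ^ 6
  total≤ p = begin
    total p
      ≤⟨ ∑-≤ (λ v → ≤-trans (∑-≤ (gain≤ v p) (wedges v)) (*-monoˡ-≤ (N ^ 3) (length-wedges v))) V ⟩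
    length V * (N ^ 2 * N ^ 3) ≡⟨ cong₂ _*_ length-V (sym (^-distribˡ-+-* N 2 3)) ⟩
    n * N ^ 5               ≤⟨ *-monoˡ-≤ (N ^ 5) n≤N ⟩
    N ^ 6                   ∎
    where open ≤-Reasoning

  N^k<W : ∀ k → k < 8 → N ^ k < W
  N^k<W k k<8 = ^-monoʳ-< N 2≤N k<8

  0<W : 0 < W
  0<W = ≤-<-trans z≤n (N^k<W 0 (s≤s z≤n))

  1<W : 1 < W
  1<W = N^k<W 0 (s≤s z≤n)

  ≤m₂⇒<W : ∀ {a} → a ≤ m₂ → a < W
  ≤m₂⇒<W a≤ = ≤-<-trans (≤-trans a≤ m₂≤N²) (N^k<W 2 (s≤s (s≤s (s≤s z≤n))))

  ≤n⇒<W : ∀ {a} → a ≤ n → a < W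
  ≤n⇒<W a≤ = ≤-<-trans (≤-trans a≤ (≤-trans n≤N (≤-reflexive (sym (*-identityʳ N))))) (N^k<W 1 (s≤s (s≤s z≤n)))

  toℕ<W : ∀ (v : Fin n) → toℕ v < W
  toℕ<W v = ≤n⇒<W (<⇒≤ (toℕ<n v))

  S = n + m₂

  toℕ<S : ∀ (v : Fin n) → toℕ v < S
  toℕ<S v = ≤-trans (toℕ<n v) (m≤m+n n m₂)

  <m₂⇒<S : ∀ {c} → c < m₂ → c < S
  <m₂⇒<S c< = ≤-trans c< (m≤n+m m₂ n)

  cell<S : ∀ {c p} → cells [ c ]= p → c < S
  cell<S p = <m₂⇒<S ([]=⇒<m₂ p)

-- The program

pattern rOne = Fin.zero
pattern rM   = Fin.suc rOne
pattern rJ   = Fin.suc rM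
pattern rV   = Fin.suc rJ
pattern rDv  = Fin.suc rV
pattern rE   = Fin.suc rDv
pattern rI   = Fin.suc rE
pattern rU   = Fin.suc rI
pattern rDu  = Fin.suc rU
pattern rF   = Fin.suc rDu
pattern rK   = Fin.suc rF
pattern rW   = Fin.suc rK
pattern rDw  = Fin.suc rW
pattern rFl  = Fin.suc rDw
pattern rT   = Fin.suc rFl
pattern rT₂  = Fin.suc rT

pattern iDegree   = Fin.zero
pattern iOffset   = Fin.suc iDegree
pattern iAdjacent = Fin.suc iOffset

-- While the wedges v u w with a fixed v are scanned, aCount[w] is the number of
-- those seen so far and aExtra[w] is one less, as the machine cannot subtract.
-- aOwner[offset v] = v, so that isolated vertices, which would not fit into
-- O(mδ̄) time, are never visited.  aGain and aTwin are indexed like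
-- adjacencyArray, and aTwin links the cells of u→v and v→u.
pattern aCount = Fin.zero
pattern aExtra = Fin.suc aCount
pattern aOwner = Fin.suc aExtra
pattern aGain  = Fin.suc aOwner
pattern aTwin  = Fin.suc aGain
pattern aOut   = Fin.suc aTwin

Prog : Set
Prog = Program 3 16 6

compare : Fin 16 → Fin 16 → Prog
compare x dx =
  rFl ≔ const 0 ⨾
  (if (dx ≺ rDv) then (rFl ≔ const 1)
   else (if (dx ≐ rDv) then (if (x ≺ rV) then (rFl ≔ const 1) else skip) else skip))

scanNeighbour : Prog → Prog
scanNeighbour B =
  while (rK ≺ rF) run
    (rW ≔ input iAdjacent rK ⨾
     B ⨾
     rK ≔ (rK ⊕ rOne))

scanSpokes : Prog → Prog
scanSpokes B =
  while (rI ≺ rE) run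
    (rU ≔ input iAdjacent rI ⨾
     rDu ≔ input iDegree rU ⨾
     compare rU rDu ⨾
     (if (rFl ≐ rOne)
      then (rK ≔ input iOffset rU ⨾ rF ≔ (rK ⊕ rDu) ⨾ scanNeighbour B)
      else skip) ⨾
     rI ≔ (rI ⊕ rOne))

scanWedges : Prog → Prog
scanWedges B = rI ≔ copy rJ ⨾ scanSpokes B

countWedge addGains resetWedge : Prog

countWedge =
  rT ≔ load aCount rW ⨾
  aExtra [ rW ]≔ʷ rT ⨾
  rT ≔ (rT ⊕ rOne) ⨾
  aCount [ rW ]≔ʷ rT

addGains =
  rDw ≔ input iDegree rW ⨾
  compare rW rDw ⨾
  (if (rFl ≐ rOne)
   then (rT ≔ load aExtra rW ⨾
         rT₂ ≔ load aGain rI ⨾ rT₂ ≔ (rT₂ ⊕ rT) ⨾ aGain [ rI ]≔ʷ rT₂ ⨾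
         rT₂ ≔ load aGain rK ⨾ rT₂ ≔ (rT₂ ⊕ rT) ⨾ aGain [ rK ]≔ʷ rT₂)
   else skip)

resetWedge =
  rT ≔ const 0 ⨾
  aCount [ rW ]≔ʷ rT ⨾
  (if (rW ≐ rV) then (aTwin [ rI ]≔ʷ rK ⨾ aTwin [ rK ]≔ʷ rI) else skip)

initialise countAll combine algorithm : Prog

initialise =
  while (rK ≺ rM) run
    (rW ≔ input iAdjacent rK ⨾
     rT ≔ const 0 ⨾
     aCount [ rW ]≔ʷ rT ⨾
     aGain [ rK ]≔ʷ rT ⨾
     rF ≔ input iOffset rW ⨾
     aOwner [ rF ]≔ʷ rW ⨾
     rK ≔ (rK ⊕ rOne))

countAll =
  while (rJ ≺ rM) run
    (rV ≔ load aOwner rJ ⨾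
     rDv ≔ input iDegree rV ⨾
     rE ≔ (rJ ⊕ rDv) ⨾
     scanWedges countWedge ⨾
     scanWedges addGains ⨾
     scanWedges resetWedge ⨾
     rJ ≔ copy rE)

combine =
  while (rK ≺ rM) run
    (rF ≔ load aTwin rK ⨾
     rT ≔ load aGain rK ⨾
     rT₂ ≔ load aGain rF ⨾
     rT ≔ (rT ⊕ rT₂) ⨾
     aOut [ rK ]≔ʷ rT ⨾
     rK ≔ (rK ⊕ rOne))

algorithm =
  rOne ≔ const 1 ⨾
  rM ≔ size iAdjacent ⨾
  rK ≔ const 0 ⨾
  initialise ⨾
  rJ ≔ const 0 ⨾
  countAll ⨾
  rK ≔ const 0 ⨾
  combine

record Outer : Set where
  constructor outer
  field j v dv e : ℕ

record Middle : Set where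
  constructor middle
  field i u du f : ℕ

record Temporaries : Set where
  constructor temporaries
  field w dw fl t t₂ : ℕ

record Memory (S : ℕ) : Set where
  constructor memory
  field counter extra owner credit twin out : Vec ℕ S

-- Loops and their invariants

module Execution {n : ℕ} (G : Graph n) (L : AdjacencyLists G) where
  open Graph G
  open AdjacencyLists L
  open Layout G L public
  open Logic {3} {16} {6} (encode L) S W public
  open Semantics {3} {16} {6} (encode L) S W public

  state : Outer → Middle → ℕ → Temporaries → Memory S → State 16 6 S
  state o q k z X =
    ⟨ 1 ∷ m₂ ∷ O.j ∷ O.v ∷ O.dv ∷ O.e ∷ M.i ∷ M.u ∷ M.du ∷ M.f ∷ k ∷ T.w ∷ T.dw ∷ T.fl ∷ T.t ∷ T.t₂ ∷ []
    , X.counter ∷ X.extra ∷ X.owner ∷ X.credit ∷ X.twin ∷ X.out ∷ [] ⟩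
    where
    module O = Outer o
    module M = Middle q
    module T = Temporaries z
    module X = Memory X

  step : ∀ {ρ μ x e v P T Q} → ⟨ ρ , μ ⟩ ⊢ e ⇓ v → v < W →
         Exec P ⟨ ρ [ x ]≔ v , μ ⟩ T Q → Exec (x ≔ e ⨾ P) ⟨ ρ , μ ⟩ (1 + T) Q
  step e⇓v v<W p = exec-seq (exec-≔ e⇓v v<W p)

  stepˢ : ∀ {ρ μ a x y P T Q} → lookup ρ x < S →
          Exec P ⟨ ρ , μ [ a ]≔ set (lookup μ a) (lookup ρ x) (lookup ρ y) ⟩ T Q →
          Exec (a [ x ]≔ʷ y ⨾ P) ⟨ ρ , μ ⟩ (1 + T) Q
  stepˢ x<S p = exec-seq (exec-store x<S p)

  compare-correct : ∀ {u v o q k z X Q} x dx →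
    Outer.v o ≡ toℕ v → Outer.dv o ≡ d v →
    let σ = λ fl → state o q k (record z { fl = fl }) X in
    (∀ fl → lookup (State.regs (σ fl)) x ≡ toℕ u) → (∀ fl → lookup (State.regs (σ fl)) dx ≡ d u) →
    Q (σ (𝟙 (u ◁? v))) → Exec (compare x dx) (state o q k z X) 5 Q
  compare-correct {u} {v} {o} {q} {k} {z} {X} {Q} x dx ev edv ex edx = λ qQ →
    step const 0<W (exec-if (_ <? _)
      (λ h → weakenᵗ (s≤s z≤n) (exec-≔ const 1<W (result 1 (𝟙-yes (u ◁? v) (inj₁ (lt dx edx edv h))) qQ)))
      (λ ¬h → exec-if (_ ℕ.≟ _)
        (λ h′ → exec-if (_ <? _)
          (λ h″ → exec-≔ const 1<W (result 1 (𝟙-yes (u ◁? v) (inj₂ (eq h′ , lt x ex ev h″))) qQ))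
          (λ ¬h″ → exec-skip (result 0 (𝟙-no (u ◁? v)
            λ { (inj₁ p) → ¬h (tl dx edx edv p) ; (inj₂ (_ , p)) → ¬h″ (tl x ex ev p) }) qQ)))
        (λ ¬h′ → weakenᵗ (s≤s z≤n) (exec-skip (result 0 (𝟙-no (u ◁? v)
          λ { (inj₁ p) → ¬h (tl dx edx edv p) ; (inj₂ (e , _)) → ¬h′ (trans (edx 0) (trans e (sym edv))) }) qQ)))))
    where
    σ = λ fl → state o q k (record z { fl = fl }) X
    result : ∀ b → 𝟙 (u ◁? v) ≡ b → Q (σ (𝟙 (u ◁? v))) → Q (σ b)
    result b e = subst (λ b → Q (σ b)) e
    lt : ∀ x {a b b′} → (∀ fl → lookup (State.regs (σ fl)) x ≡ a) → b′ ≡ b → lookup (State.regs (σ 0)) x < b′ → a < b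
    lt _ f e = subst₂ _<_ (f 0) e
    tl : ∀ x {a b b′} → (∀ fl → lookup (State.regs (σ fl)) x ≡ a) → b′ ≡ b → a < b → lookup (State.regs (σ 0)) x < b′
    tl _ f e = subst₂ _<_ (sym (f 0)) (sym e)
    eq : lookup (State.regs (σ 0)) dx ≡ Outer.dv o → d u ≡ d v
    eq h = trans (sym (edx 0)) (trans h edv)

module Scan {n : ℕ} (G : Graph n) (L : AdjacencyLists G) where
  open Graph G
  open AdjacencyLists L
  open Execution G L public

  spokes-◁ : ∀ {v u} → u ◁ v → spokes v u ≡ map (u ,_) (nbrs u)
  spokes-◁ {v} {u} p with u ◁? v
  ... | yes _ = refl
  ... | no ¬p = contradiction p ¬p

  spokes-⋪ : ∀ {v u} → ¬ (u ◁ v) → spokes v u ≡ []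
  spokes-⋪ {v} {u} ¬p with u ◁? v
  ... | yes p = contradiction p ¬p
  ... | no _  = refl

  frame : Fin n → Outer
  frame v = outer (offset v) (toℕ v) (d v) (offset v + d v)

  Invariant : Set₁
  Invariant = List (Fin n × Fin n) → Memory S → Set

  -- 14 is the running time of addGains, the longest of the three bodies.
  Preserves : Fin n → Prog → Invariant → Set
  Preserves v B I = ∀ {es u w rest i du f k z X} → wedges v ≡ es ++ (u , w) ∷ rest →
    cells [ i ]= (v , u) → cells [ k ]= (u , w) → Temporaries.w z ≡ toℕ w → I es X →
    Exec B (state (frame v) (middle i (toℕ u) du f) k z X) 14 λ s →
      ∃[ z′ ] ∃[ X′ ] (s ≡ state (frame v) (middle i (toℕ u) du f) k z′ X′ × I (es ++ (u , w) ∷ []) X′)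

  cost : Fin n → Fin n → ℕ
  cost v u = 13 + 𝟙 (u ◁? v) * (d u * 17)

  module _ {v : Fin n} {B : Prog} {I : Invariant} (B-preserves : Preserves v B I) where

    scanNeighbour-correct : ∀ {u} ws rest {es rest′ i du k z X} →
      nbrs u ≡ ws ++ rest → wedges v ≡ es ++ map (u ,_) rest ++ rest′ →
      cells [ i ]= (v , u) → k ≡ offset u + length ws → I es X →
      Exec (scanNeighbour B) (state (frame v) (middle i (toℕ u) du (offset u + d u)) k z X) (1 + length rest * 17) λ s →
        ∃[ k′ ] ∃[ z′ ] ∃[ X′ ] (s ≡ state (frame v) (middle i (toℕ u) du (offset u + d u)) k′ z′ X′ ×
                                 I (es ++ map (u ,_) rest) X′)
    scanNeighbour-correct {u} ws [] {es} eq _ _ refl inv = exec-stop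
      (λ h → <-irrefl (cong (offset u +_) (trans (cong length (trans (sym (++-identityʳ ws)) (sym eq))) (length-nbrs u))) h)
      (_ , _ , _ , refl , subst (λ es → I es _) (sym (++-identityʳ es)) inv)
    scanNeighbour-correct {u} ws (w ∷ rest) {es} {rest′} eq eqʷ ci refl inv = exec-loop
      (+-monoʳ-< (offset u) (subst (length ws <_) (length-nbrs u) ([]=⇒< at)))
      (step (eval-input (adjacencyArray-[]= ck)) (toℕ<W w)
        (exec-seq (weaken ≤-refl
          (λ { (z′ , X′ , refl , inv′) →
            exec-≔ add (≤m₂⇒<W (subst (_≤ m₂) (+-comm 1 _) ([]=⇒<m₂ ck)))
              (weaken ≤-refl
                (λ { (k″ , z″ , X″ , refl , inv″) → k″ , z″ , X″ , refl , subst (λ es → I es X″) (++-assoc es _ _) inv″ })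
                (scanNeighbour-correct (ws ++ w ∷ []) rest
                  (trans eq (sym (++-assoc ws (w ∷ []) rest)))
                  (trans eqʷ (sym (++-assoc es ((u , w) ∷ []) _)))
                  ci
                  (trans (+-assoc (offset u) (length ws) 1) (cong (offset u +_) (sym (length-++ ws))))
                  inv′)) })
          (B-preserves eqʷ ci ck refl inv))))
      where
      at : nbrs u [ length ws ]= w
      at = []=-split ws eq
      ck : cells [ offset u + length ws ]= (u , w)
      ck = cells-[]= u at

    scanSpokes-correct : ∀ us rest {es q k z X} →
      nbrs v ≡ us ++ rest → wedges v ≡ es ++ concatMap (spokes v) rest →
      Middle.i q ≡ offset v + length us → I es X →
      Exec (scanSpokes B) (state (frame v) q k z X) (1 + ∑ rest (cost v)) λ s →
        ∃[ q′ ] ∃[ k′ ] ∃[ z′ ] ∃[ X′ ] (s ≡ state (frame v) q′ k′ z′ X′ × I (es ++ concatMap (spokes v) rest) X′)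
    scanSpokes-correct us [] {es} eq _ refl inv = exec-stop
      (λ h → <-irrefl (cong (offset v +_) (trans (cong length (trans (sym (++-identityʳ us)) (sym eq))) (length-nbrs v))) h)
      (_ , _ , _ , _ , refl , subst (λ es → I es _) (sym (++-identityʳ es)) inv)
    scanSpokes-correct us (u ∷ rest) {es} eq eqʷ refl inv = spoke (u ◁? v)
      where
      at : nbrs v [ length us ]= u
      at = []=-split us eq
      ci : cells [ offset v + length us ]= (v , u)
      ci = cells-[]= v at
      i<e : offset v + length us < offset v + d v
      i<e = +-monoʳ-< (offset v) (subst (length us <_) (length-nbrs v) ([]=⇒< at))
      Post = λ s → ∃[ q′ ] ∃[ k′ ] ∃[ z′ ] ∃[ X′ ]
        (s ≡ state (frame v) q′ k′ z′ X′ × I (es ++ concatMap (spokes v) (u ∷ rest)) X′)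
      next : ∀ {q k z X} → Middle.i q ≡ offset v + length us → I (es ++ spokes v u) X →
        Exec (rI ≔ (rI ⊕ rOne)) (state (frame v) q k z X) 1 λ s →
          Exec (scanSpokes B) s (1 + ∑ rest (cost v)) Post
      next {q} {k} {z} {X} refl inv′ = exec-≔ add (≤m₂⇒<W (subst (_≤ m₂) (+-comm 1 _) ([]=⇒<m₂ ci)))
        (weaken ≤-refl
          (λ { (q″ , k″ , z″ , X″ , refl , inv″) →
            q″ , k″ , z″ , X″ , refl , subst (λ es → I es X″) (++-assoc es _ _) inv″ })
          (scanSpokes-correct (us ++ u ∷ []) rest
            {q = record q { i = offset v + length us + 1 }} {k} {z} {X}
            (trans eq (sym (++-assoc us (u ∷ []) rest)))
            (trans eqʷ (sym (++-assoc es (spokes v u) _)))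
            (trans (+-assoc (offset v) (length us) 1) (cong (offset v +_) (sym (length-++ us))))
            inv′))
      prologue : ∀ {q k z X T} → Middle.i q ≡ offset v + length us →
        (∀ {q′ z′} → Middle.i q′ ≡ offset v + length us → Middle.u q′ ≡ toℕ u → Middle.du q′ ≡ d u → Temporaries.fl z′ ≡ 𝟙 (u ◁? v) →
          Exec (if (rFl ≐ rOne) then (rK ≔ input iOffset rU ⨾ rF ≔ (rK ⊕ rDu) ⨾ scanNeighbour B) else skip)
            (state (frame v) q′ k z′ X) (suc T) λ s → Exec (rI ≔ (rI ⊕ rOne)) s 1 λ s → Exec (scanSpokes B) s (1 + ∑ rest (cost v)) Post) →
        Exec (scanSpokes B) (state (frame v) q k z X) (suc (7 + (suc T + 1) + (1 + ∑ rest (cost v)))) Post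
      prologue {q} {k} {z} {X} refl p = exec-loop i<e
        (step (eval-input (adjacencyArray-[]= ci)) (toℕ<W u)
        (step (eval-input (degreeArray-[]= u)) (≤n⇒<W (degree≤n u))
        (exec-seq (compare-correct {u} {v} {frame v} {middle (offset v + length us) (toℕ u) (d u) _} {k} {z} {X}
          rU rDu refl refl (λ _ → refl) (λ _ → refl)
          (exec-seq (p refl refl refl refl))))))
      time : ∀ x s → suc (7 + (suc (3 + x) + 1) + (1 + s)) ≡ 1 + (13 + x + s)
      time = solve 2 (λ x s → con 1 :+ (con 7 :+ (con 1 :+ (con 3 :+ x) :+ con 1) :+ (con 1 :+ s)) :=
                              con 1 :+ (con 13 :+ x :+ s)) refl
        where open +-*-Solver
      spoke : Dec (u ◁ v) → Exec (scanSpokes B) (state (frame v) _ _ _ _) (1 + ∑ (u ∷ rest) (cost v)) Post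
      spoke (yes p) = weakenᵗ
        (≤-reflexive (trans (time (length (nbrs u) * 17) (∑ rest (cost v)))
          (cong (λ x → 1 + (13 + x + ∑ rest (cost v)))
            (trans (cong (_* 17) (length-nbrs u))
                   (sym (trans (cong (_* (d u * 17)) (𝟙-yes (u ◁? v) p)) (*-identityˡ _)))))))
        (prologue refl λ { {middle _ _ _ _} refl refl refl fl → exec-if (_ ℕ.≟ _)
          (λ _ → step (eval-input (offsetArray-[]= u)) (≤m₂⇒<W (≤-trans (m≤m+n _ _) (offset+degree≤m₂ u)))
                 (step add (≤m₂⇒<W (offset+degree≤m₂ u))
                 (weaken ≤-refl
                   (λ { (_ , _ , X′ , refl , inv′) →
                     next refl (subst (λ xs → I (es ++ xs) X′) (sym (spokes-◁ p)) inv′) })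
                   (scanNeighbour-correct [] (nbrs u) {rest′ = concatMap (spokes v) rest} refl
                     (trans eqʷ (cong (λ xs → es ++ xs ++ concatMap (spokes v) rest) (spokes-◁ p)))
                     ci (sym (+-identityʳ (offset u))) inv))))
          (λ ¬h → contradiction (trans fl (𝟙-yes (u ◁? v) p)) ¬h) })
      spoke (no ¬p) = weakenᵗ
        (≤-trans (m≤m+n _ 2) (≤-reflexive (trans (time₀ (∑ rest (cost v)))
          (cong (λ x → 1 + (13 + x * (d u * 17) + ∑ rest (cost v))) (sym (𝟙-no (u ◁? v) ¬p))))))
        (prologue refl λ { {middle _ _ _ _} refl refl refl fl → exec-if (_ ℕ.≟ _)
          (λ h → contradiction (trans (sym (𝟙-no (u ◁? v) ¬p)) (trans (sym fl) h)) λ ())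
          (λ _ → exec-skip (next refl
            (subst (λ es → I es _) (sym (trans (cong (es ++_) (spokes-⋪ ¬p)) (++-identityʳ es))) inv))) })
        where
        time₀ : ∀ s → suc (7 + (suc 1 + 1) + (1 + s)) + 2 ≡ 1 + (13 + s)
        time₀ =
          solve 1 (λ s → con 1 :+ (con 7 :+ (con 2 :+ con 1) :+ (con 1 :+ s)) :+ con 2 := con 1 :+ (con 13 :+ s)) refl
          where open +-*-Solver

    scanWedges-correct : ∀ {q k z X} → I [] X →
      Exec (scanWedges B) (state (frame v) q k z X) (1 + (1 + ∑ (nbrs v) (cost v))) λ s →
        ∃[ q′ ] ∃[ k′ ] ∃[ z′ ] ∃[ X′ ] (s ≡ state (frame v) q′ k′ z′ X′ × I (wedges v) X′)
    scanWedges-correct inv = step copy (≤m₂⇒<W (≤-trans (m≤m+n _ _) (offset+degree≤m₂ v)))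
      (scanSpokes-correct [] (nbrs v) refl refl (sym (+-identityʳ (offset v))) inv)

module Phases {n : ℕ} (G : Graph n) (L : AdjacencyLists G) where
  open Graph G
  open AdjacencyLists L
  open Scan G L public
  open Memory

  Counts Extras : List (Fin n × Fin n) → Vec ℕ S → Set
  Counts es A = ∀ w → Live w → get A (toℕ w) ≡ count es w
  Extras es A = ∀ w → 0 < count es w → get A (toℕ w) ≡ count es w ∸ 1

  Owners : Vec ℕ S → Set
  Owners A = ∀ w → Live w → get A (offset w) ≡ toℕ w

  Gains : (Fin n × Fin n → ℕ) → Vec ℕ S → Set
  Gains b A = ∀ c p → cells [ c ]= p → get A c ≡ b p

  Twin : Vec ℕ S → Fin n × Fin n → Set
  Twin A p = ∀ c → cells [ c ]= p → cells [ get A c ]= swap p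

  Twins : List (Fin n) → Vec ℕ S → Set
  Twins vs A = ∀ v u → v ∈ vs → Adj v u → u ◁ v → Twin A (v , u) × Twin A (u , v)

  count-∷ʳ : ∀ es {u w} w′ → count (es ++ (u , w) ∷ []) w′ ≡ count es w′ + 𝟙 (w′ ≟ w)
  count-∷ʳ es {u} {w} w′ = ∑-∷ʳ (λ (_ , w) → 𝟙 (w′ ≟ w)) es (u , w)

  count-∷ʳ-≡ : ∀ es {u} w → count (es ++ (u , w) ∷ []) w ≡ count es w + 1
  count-∷ʳ-≡ es w = trans (count-∷ʳ es w) (cong (count es w +_) (𝟙-yes (w ≟ w) refl))

  count-∷ʳ-≢ : ∀ es {u w w′} → w′ ≢ w → count (es ++ (u , w) ∷ []) w′ ≡ count es w′
  count-∷ʳ-≢ es {w = w} {w′} ne = trans (count-∷ʳ es w′)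
    (trans (cong (count es w′ +_) (𝟙-no (w′ ≟ w) ne)) (+-identityʳ _))

  ∈-wedges⁻ : ∀ {v u w} → (u , w) ∈ wedges v → u ◁ v
  ∈-wedges⁻ {v} p with find (∈-concatMap⁻ (spokes v) {xs = nbrs v} p)
  ... | u′ , _ , q with u′ ◁? v
  ...   | yes u◁v with ∈-map⁻ _ q
  ...     | _ , _ , refl = u◁v

  ∈-wedges⁺ : ∀ {v u w} → Adj v u → u ◁ v → Adj u w → (u , w) ∈ wedges v
  ∈-wedges⁺ {v} {u} {w} vu u◁v uw = ∈-concatMap⁺ (spokes v) (lose (Adj⇒∈-nbrs vu)
    (subst ((u , w) ∈_) (sym (spokes-◁ u◁v)) (∈-map⁺ (u ,_) (Adj⇒∈-nbrs uw))))

  count-∈ : ∀ {es u w} → (u , w) ∈ es → 0 < count es w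
  count-∈ {_ ∷ es} {_} {w} (here refl) = ≤-trans (≤-reflexive (sym (𝟙-yes (w ≟ w) refl))) (m≤m+n _ (count es w))
  count-∈ {(_ , w′) ∷ _} {_} {w} (there p) = ≤-trans (count-∈ p) (m≤n+m _ (𝟙 (w ≟ w′)))

  prefix-length : ∀ {v} es {e rest} → wedges v ≡ es ++ e ∷ rest → length es + 1 ≤ N ^ 2
  prefix-length {v} es {e} {rest} eq = begin
    length es + 1                 ≤⟨ +-monoʳ-≤ (length es) (s≤s z≤n) ⟩
    length es + length (e ∷ rest) ≡⟨ length-++ es ⟨
    length (es ++ e ∷ rest)       ≡⟨ cong length eq ⟨
    length (wedges v)             ≤⟨ length-wedges v ⟩
    N ^ 2                         ∎
    where open ≤-Reasoning

  N²⇒<W : ∀ {a} → a ≤ N ^ 2 → a < W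
  N²⇒<W a≤ = ≤-<-trans a≤ (N^k<W 2 (s≤s (s≤s (s≤s z≤n))))

  N⁶⇒<W : ∀ {a} → a ≤ N ^ 6 → a < W
  N⁶⇒<W a≤ = ≤-<-trans a≤ (N^k<W 6 (s≤s (s≤s (s≤s (s≤s (s≤s (s≤s (s≤s z≤n))))))))

  Counting₁ : List (Fin n) → (Fin n × Fin n → ℕ) → Invariant
  Counting₁ vs b es X = Counts es (counter X) × Extras es (extra X) ×
                        Owners (owner X) × Gains b (credit X) × Twins vs (twin X)

  countWedge-preserves : ∀ {v vs b} → Preserves v countWedge (Counting₁ vs b)
  countWedge-preserves {v} {vs} {b} {es} {u} {w} {X = X} eq ci ck refl (counts , extras , rest) =
    weakenᵗ (m≤m+n 4 10)
      (step (eval-load (toℕ<S w)) (N²⇒<W (≤-trans (m≤m+n _ 1) bound))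
      (stepˢ (toℕ<S w)
      (step add (N²⇒<W bound)
      (exec-store (toℕ<S w)
        (_ , memory _ _ _ _ _ _ , refl , counts′ , extras′ , rest)))))
    where
    live : Live w
    live = Adj⇒Live (symmetric (cells-Adj ck))
    old : get (counter X) (toℕ w) ≡ count es w
    old = counts w live
    bound : get (counter X) (toℕ w) + 1 ≤ N ^ 2
    bound = ≤-trans (+-monoˡ-≤ 1 (≤-trans (≤-reflexive old) (count≤length es w))) (prefix-length es eq)
    counts′ : Counts (es ++ (u , w) ∷ []) (set (counter X) (toℕ w) (get (counter X) (toℕ w) + 1))
    counts′ w′ live′ with w′ ≟ w
    ... | yes refl = trans (get-set-≡ (counter X) _ (toℕ<S w)) (trans (cong (_+ 1) old) (sym (count-∷ʳ-≡ es w)))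
    ... | no ne    =
      trans (get-set-≢ (counter X) _ (ne ∘ sym ∘ toℕ-injective)) (trans (counts w′ live′) (sym (count-∷ʳ-≢ es ne)))
    extras′ : Extras (es ++ (u , w) ∷ []) (set (extra X) (toℕ w) (get (counter X) (toℕ w)))
    extras′ w′ pos with w′ ≟ w
    ... | yes refl = trans (get-set-≡ (extra X) _ (toℕ<S w)) (trans old
                       (sym (trans (cong (_∸ 1) (count-∷ʳ-≡ es w)) (m+n∸n≡m (count es w) 1))))
    ... | no ne    = trans (get-set-≢ (extra X) _ (ne ∘ sym ∘ toℕ-injective))
                       (trans (extras w′ (subst (0 <_) (count-∷ʳ-≢ es ne) pos)) (cong (_∸ 1) (sym (count-∷ʳ-≢ es ne))))

  Counting₂ : Fin n → List (Fin n) → (Fin n × Fin n → ℕ) → Invariant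
  Counting₂ v vs b es X = Counts (wedges v) (counter X) × Extras (wedges v) (extra X) ×
                          Owners (owner X) × Twins vs (twin X) × Gains (λ p → b p + ∑ es (gain v p)) (credit X)

  addGains-preserves : ∀ {v vs b} → (∀ p → b p + gains v p ≤ N ^ 6) →
                       Preserves v addGains (Counting₂ v vs b)
  addGains-preserves {v} {vs} {b} b≤ {es} {u} {w} {rest} {i} {du} {f} {k} {z} {X} eq ci ck refl (counts , extras , owners , twins , G₀) =
    step (eval-input (degreeArray-[]= w)) (≤n⇒<W (degree≤n w))
    (exec-seq (compare-correct {w} {v} {frame v} {_} {k} {record z { dw = d w }} {X} rW rDw refl refl (λ _ → refl) (λ _ → refl)
    (test refl (w ◁? v))))
    where
    Post = λ s → ∃[ z′ ] ∃[ X′ ] (s ≡ state (frame v) (middle i (toℕ u) du f) k z′ X′ ×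
                                  Counting₂ v vs b (es ++ (u , w) ∷ []) X′)
    here∈ : (u , w) ∈ wedges v
    here∈ = subst ((u , w) ∈_) (sym eq) (∈-++⁺ʳ es (here refl))
    u≢v : u ≢ v
    u≢v = ◁⇒≢ (∈-wedges⁻ here∈)
    i≢k : i ≢ k
    i≢k refl = u≢v (cong proj₁ ([]=-functional ck ci))
    γ = credit X
    x = get (extra X) (toℕ w)
    current : Fin n × Fin n → ℕ
    current p = b p + ∑ es (gain v p)
    sum-gain : ∀ p → b p + ∑ (es ++ (u , w) ∷ []) (gain v p) ≡ current p + gain v p (u , w)
    sum-gain p = trans (cong (b p +_) (∑-∷ʳ (gain v p) es (u , w))) (sym (+-assoc (b p) _ _))
    bound : ∀ p → b p + ∑ es (gain v p) + gain v p (u , w) ≤ N ^ 6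
    bound p = begin
      b p + ∑ es (gain v p) + gain v p (u , w)     ≡⟨ +-assoc (b p) _ _ ⟩
      b p + (∑ es (gain v p) + gain v p (u , w))
        ≤⟨ +-monoʳ-≤ (b p) (+-monoʳ-≤ (∑ es (gain v p)) (m≤m+n _ (∑ rest (gain v p)))) ⟩
      b p + (∑ es (gain v p) + ∑ ((u , w) ∷ rest) (gain v p)) ≡⟨ cong (b p +_) (∑-++ (gain v p) es _) ⟨
      b p + ∑ (es ++ (u , w) ∷ rest) (gain v p)    ≡⟨ cong (λ es → b p + ∑ es (gain v p)) eq ⟨
      b p + gains v p                              ≤⟨ b≤ p ⟩
      N ^ 6                                        ∎
      where open ≤-Reasoning
    test : ∀ {fl} → fl ≡ 𝟙 (w ◁? v) → Dec (w ◁ v) → Exec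
      (if (rFl ≐ rOne)
       then (rT ≔ load aExtra rW ⨾
             rT₂ ≔ load aGain rI ⨾ rT₂ ≔ (rT₂ ⊕ rT) ⨾ aGain [ rI ]≔ʷ rT₂ ⨾
             rT₂ ≔ load aGain rK ⨾ rT₂ ≔ (rT₂ ⊕ rT) ⨾ aGain [ rK ]≔ʷ rT₂)
       else skip)
      (state (frame v) (middle i (toℕ u) du f) k (record z { dw = d w ; fl = fl }) X) 8 Post
    test refl (no ⋪) = weakenᵗ (m≤m+n 2 6) (exec-if (_ ℕ.≟ _)
      (λ h → contradiction (trans (sym (𝟙-no (w ◁? v) ⋪)) h) λ ())
      (λ _ → exec-skip (_ , X , refl , counts , extras , owners , twins , λ c p cp →
        trans (G₀ c p cp) (sym (trans (sum-gain p) (trans (cong (current p +_)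
          (cong (λ s → s * (codegree v w ∸ 1) * (𝟙 (p ≟₂ (v , u)) + 𝟙 (p ≟₂ (u , w)))) (𝟙-no (w ◁? v) ⋪))) (+-identityʳ _)))))))
    test refl (yes w◁v) = exec-if (_ ℕ.≟ _)
      (λ _ →
        step (eval-load (toℕ<S w)) (N⁶⇒<W (≤-trans (m≤n+m x (get γ i)) bound-i))
        (step (eval-load (cell<S ci)) (N⁶⇒<W (≤-trans (m≤m+n (get γ i) x) bound-i))
        (step add (N⁶⇒<W bound-i)
        (stepˢ (cell<S ci)
        (step (eval-load (cell<S ck)) (N⁶⇒<W (≤-trans (m≤m+n _ x) bound-k))
        (step add (N⁶⇒<W bound-k)
        (exec-store (cell<S ck) (_ , memory _ _ _ _ _ _ , refl , counts , extras , owners , twins , G₁))))))))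
      λ ¬h → contradiction (𝟙-yes (w ◁? v) w◁v) ¬h
      where
      x-score : x ≡ score v w
      x-score = trans (extras w (count-∈ here∈))
        (sym (trans (cong (_* (codegree v w ∸ 1)) (𝟙-yes (w ◁? v) w◁v)) (*-identityˡ _)))
      gain-i : gain v (v , u) (u , w) ≡ x
      gain-i = trans (cong (score v w *_) (cong₂ _+_ (𝟙-yes ((v , u) ≟₂ (v , u)) refl)
                 (𝟙-no ((v , u) ≟₂ (u , w)) (λ e → u≢v (sym (cong proj₁ e)))))) (trans (*-identityʳ _) (sym x-score))
      gain-k : gain v (u , w) (u , w) ≡ x
      gain-k = trans (cong (score v w *_) (cong₂ _+_ (𝟙-no ((u , w) ≟₂ (v , u)) (λ e → u≢v (cong proj₁ e)))
                 (𝟙-yes ((u , w) ≟₂ (u , w)) refl))) (trans (*-identityʳ _) (sym x-score))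
      γ₁ = set γ i (get γ i + x)
      value-i : get γ i + x ≡ current (v , u) + gain v (v , u) (u , w)
      value-i = cong₂ _+_ (G₀ i (v , u) ci) (sym gain-i)
      value-k : get γ₁ k + x ≡ current (u , w) + gain v (u , w) (u , w)
      value-k = cong₂ _+_ (trans (get-set-≢ γ _ i≢k) (G₀ k (u , w) ck)) (sym gain-k)
      bound-i : get γ i + x ≤ N ^ 6
      bound-i = ≤-trans (≤-reflexive value-i) (bound (v , u))
      bound-k : get γ₁ k + x ≤ N ^ 6
      bound-k = ≤-trans (≤-reflexive value-k) (bound (u , w))
      G₁ : Gains (λ p → b p + ∑ (es ++ (u , w) ∷ []) (gain v p)) (set γ₁ k (get γ₁ k + x))
      G₁ c p cp with c ℕ.≟ k | c ℕ.≟ i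
      ... | yes refl | _ with refl ← []=-functional cp ck =
        trans (get-set-≡ γ₁ _ (cell<S ck)) (trans value-k (sym (sum-gain p)))
      G₁ c p cp | no c≢k | yes refl with refl ← []=-functional cp ci =
        trans (get-set-≢ γ₁ _ (≢-sym c≢k)) (trans (get-set-≡ γ _ (cell<S ci)) (trans value-i (sym (sum-gain p))))
      G₁ c p cp | no c≢k | no c≢i = trans (get-set-≢ γ₁ _ (≢-sym c≢k)) (trans (get-set-≢ γ _ (≢-sym c≢i))
        (trans (G₀ c p cp) (sym (trans (sum-gain p) (trans (cong (current p +_)
          (trans (cong (score v w *_) (cong₂ _+_
              (𝟙-no (p ≟₂ (v , u)) (λ { refl → c≢i ([]=-injective unique-cells cp ci) }))
              (𝟙-no (p ≟₂ (u , w)) (λ { refl → c≢k ([]=-injective unique-cells cp ck) }))))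
            (*-zeroʳ (score v w))))
          (+-identityʳ _))))))

module Correctness {n : ℕ} (G : Graph n) (L : AdjacencyLists G) where
  open Graph G
  open AdjacencyLists L
  open Phases G L public
  open Memory

  set-Twin : ∀ R {i k p p₀} → cells [ i ]= p → cells [ k ]= swap p → Twin R p₀ → Twin (set R i k) p₀
  set-Twin R {i} {k} ci ck t c cp with c ℕ.≟ i
  ... | yes refl with refl ← []=-functional cp ci =
    subst (λ a → cells [ a ]= _) (sym (get-set-≡ R k (cell<S ci))) ck
  set-Twin R {i} {k} ci ck t c cp | no c≢i =
    subst (λ a → cells [ a ]= _) (sym (get-set-≢ R k (≢-sym c≢i))) (t c cp)

  set-Twin-≡ : ∀ R {i k p} → cells [ i ]= p → cells [ k ]= swap p → Twin (set R i k) p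
  set-Twin-≡ R {i} {k} ci ck c cp with refl ← []=-injective unique-cells cp ci =
    subst (λ a → cells [ a ]= _) (sym (get-set-≡ R k (cell<S ci))) ck

  Cleared : Fin n → List (Fin n × Fin n) → Vec ℕ S → Set
  Cleared v es A = ∀ w → Live w →
    get A (toℕ w) ≡ 0 ⊎ (get A (toℕ w) ≡ count (wedges v) w × (∀ u → (u , w) ∉ es))

  Counting₃ : Fin n → List (Fin n) → (Fin n × Fin n → ℕ) → Invariant
  Counting₃ v vs b es X = Cleared v es (counter X) × Owners (owner X) × Gains b (credit X) ×
    Twins vs (twin X) × (∀ u → (u , v) ∈ es → Twin (twin X) (v , u) × Twin (twin X) (u , v))

  resetWedge-preserves : ∀ {v vs b} → Preserves v resetWedge (Counting₃ v vs b)
  resetWedge-preserves {v} {vs} {b} {es} {u} {w} {i = i} {k = k} {X = X} eq ci ck refl (cleared , owners , gs , twins , new) =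
    weakenᵗ (m≤m+n 5 9)
      (step const 0<W
      (stepˢ (toℕ<S w)
      (exec-if (_ ℕ.≟ _)
        (λ h → let ck′ = subst (λ w → cells [ k ]= (u , w)) (toℕ-injective h) ck in
          stepˢ (cell<S ci) (exec-store (cell<S ck)
            (_ , memory _ _ _ _ _ _ , refl , cleared′ , owners , gs ,
             (λ v′ u′ v∈ a p → let t , t′ = twins v′ u′ v∈ a p in keep ck′ t , keep ck′ t′) ,
             λ u′ u∈ → case ∈-++⁻ es u∈ of λ
               { (inj₁ q)           → let t , t′ = new u′ q in keep ck′ t , keep ck′ t′
               ; (inj₂ (here refl)) → set-Twin (set (twin X) i k) ck ci (set-Twin-≡ (twin X) ci ck) ,
                                      set-Twin-≡ (set (twin X) i k) ck ci })))
        (λ ¬h → weakenᵗ (s≤s z≤n) (exec-skip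
          (_ , memory _ _ _ _ _ _ , refl , cleared′ , owners , gs , twins ,
           λ u′ u∈ → case ∈-++⁻ es u∈ of λ
             { (inj₁ q)           → new u′ q
             ; (inj₂ (here refl)) → contradiction refl ¬h }))))))
    where
    keep : ∀ {p} → cells [ k ]= (u , v) → Twin (twin X) p → Twin (set (set (twin X) i k) k i) p
    keep ck′ t = set-Twin (set (twin X) i k) ck′ ci (set-Twin (twin X) ci ck′ t)
    cleared′ : Cleared v (es ++ (u , w) ∷ []) (set (counter X) (toℕ w) 0)
    cleared′ w′ live with w′ ≟ w
    ... | yes refl = inj₁ (get-set-≡ (counter X) 0 (toℕ<S w))
    ... | no ne with cleared w′ live
    ...   | inj₁ e       = inj₁ (trans (get-set-≢ (counter X) 0 (ne ∘ sym ∘ toℕ-injective)) e)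
    ...   | inj₂ (e , ∉) = inj₂ (trans (get-set-≢ (counter X) 0 (ne ∘ sym ∘ toℕ-injective)) e ,
      λ u′ u∈ → case ∈-++⁻ es u∈ of λ { (inj₁ q) → ∉ u′ q ; (inj₂ (here refl)) → ne refl })

  Initialised : List (Fin n × Fin n) → Memory S → Set
  Initialised ps X =
    (∀ u w → (u , w) ∈ ps → get (counter X) (toℕ w) ≡ 0 × get (owner X) (offset w) ≡ toℕ w) ×
    (∀ c → c < length ps → get (credit X) c ≡ 0)

  initialise-correct : ∀ ps rest {o q k z X} → cells ≡ ps ++ rest → k ≡ length ps → Initialised ps X →
    Exec initialise (state o q k z X) (1 + length rest * 8) λ s →
      ∃[ q′ ] ∃[ k′ ] ∃[ z′ ] ∃[ X′ ] (s ≡ state o q′ k′ z′ X′ × Initialised cells X′)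
  initialise-correct ps [] {X = X} eq refl inv = exec-stop
    (λ h → <-irrefl (trans (cong length (trans (sym (++-identityʳ ps)) (sym eq))) length-cells) h)
    (_ , _ , _ , _ , refl , subst (λ ps → Initialised ps X) (trans (sym (++-identityʳ ps)) (sym eq)) inv)
  initialise-correct ps ((u , w) ∷ rest) {X = X} eq refl (I₁ , I₂) = exec-loop ([]=⇒<m₂ at)
    (step (eval-input (adjacencyArray-[]= at)) (toℕ<W w)
    (step const 0<W
    (stepˢ (toℕ<S w)
    (stepˢ (cell<S at)
    (step (eval-input (offsetArray-[]= w)) (≤m₂⇒<W (<⇒≤ offset<))
    (stepˢ (<m₂⇒<S offset<)
    (exec-≔ add (≤m₂⇒<W (subst (_≤ m₂) (+-comm 1 _) ([]=⇒<m₂ at)))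
      (initialise-correct (ps ++ (u , w) ∷ []) rest {X = memory _ _ _ _ _ _}
        (trans eq (sym (++-assoc ps _ rest))) (sym (length-++ ps)) (I₁′ , I₂′)))))))))
    where
    at : cells [ length ps ]= (u , w)
    at = []=-split ps eq
    live : Live w
    live = Adj⇒Live (symmetric (cells-Adj at))
    offset< : offset w < m₂
    offset< = []=⇒<m₂ (proj₂ (first-cell live))
    I₁′ : ∀ u′ w′ → (u′ , w′) ∈ ps ++ (u , w) ∷ [] →
          get (set (counter X) (toℕ w) 0) (toℕ w′) ≡ 0 × get (set (owner X) (offset w) (toℕ w)) (offset w′) ≡ toℕ w′
    I₁′ u′ w′ p with w′ ≟ w
    ... | yes refl = get-set-≡ (counter X) 0 (toℕ<S w) , get-set-≡ (owner X) (toℕ w) (<m₂⇒<S offset<)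
    ... | no ne with ∈-++⁻ ps p
    ...   | inj₂ (here refl) = contradiction refl ne
    ...   | inj₁ q = trans (get-set-≢ (counter X) 0 (ne ∘ sym ∘ toℕ-injective)) (proj₁ (I₁ u′ w′ q)) ,
                     trans (get-set-≢ (owner X) (toℕ w) (ne ∘ sym ∘ offset-injective live live′)) (proj₂ (I₁ u′ w′ q))
      where
      live′ : Live w′
      live′ = Adj⇒Live (symmetric (cells-Adj (proj₂ (∈⇒[]= (subst ((u′ , w′) ∈_) (sym eq) (∈-++⁺ˡ q))))))
    I₂′ : ∀ c → c < length (ps ++ (u , w) ∷ []) → get (set (credit X) (length ps) 0) c ≡ 0
    I₂′ c c< with c ℕ.≟ length ps
    ... | yes refl = get-set-≡ (credit X) 0 (cell<S at)
    ... | no ne    = trans (get-set-≢ (credit X) 0 (≢-sym ne))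
      (I₂ c (≤∧≢⇒< (≤-pred (≤-trans c< (≤-reflexive (trans (length-++ ps) (+-comm _ 1))))) ne))

  Processed : List (Fin n) → Memory S → Set
  Processed vs X = (∀ w → Live w → get (counter X) (toℕ w) ≡ 0) × Owners (owner X) ×
                   Gains (λ p → ∑ vs λ v → gains v p) (credit X) × Twins vs (twin X)

  Initialised⇒Processed : ∀ {X} → Initialised cells X → Processed [] X
  Initialised⇒Processed (I₁ , I₂) =
    (λ w live → proj₁ (I₁ _ w (target live))) ,
    (λ w live → proj₂ (I₁ _ w (target live))) ,
    (λ c p cp → I₂ c ([]=⇒< cp)) ,
    λ v u ()
    where
    target : ∀ {w} → (live : Live w) → (proj₁ (first-cell live) , w) ∈ cells
    target live = []=⇒∈ (proj₂ (Adj-cells (symmetric (cells-Adj (proj₂ (first-cell live))))))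

  vertexCost : Fin n → ℕ
  vertexCost v = ∑ (nbrs v) λ u → 11 + 3 * cost v u

  isolated : ∀ {v} → ¬ Live v → nbrs v ≡ []
  isolated {v} ¬live with nbrs v in eq
  ... | []     = refl
  ... | _ ∷ _ = contradiction (subst (0 <_) (trans (cong length (sym eq)) (length-nbrs v)) (s≤s z≤n)) ¬live

  gains-prefix : ∀ {vs v rest} → V ≡ vs ++ v ∷ rest → ∀ p → (∑ vs λ v → gains v p) + gains v p ≤ N ^ 6
  gains-prefix {vs} {v} {rest} eq p = begin
    ∑ vs g + g v          ≤⟨ +-monoʳ-≤ (∑ vs g) (m≤m+n (g v) (∑ rest g)) ⟩
    ∑ vs g + ∑ (v ∷ rest) g ≡⟨ ∑-++ g vs (v ∷ rest) ⟨
    ∑ (vs ++ v ∷ rest) g  ≡⟨ cong (λ xs → ∑ xs g) eq ⟨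
    total p               ≤⟨ total≤ p ⟩
    N ^ 6                 ∎
    where
    open ≤-Reasoning
    g = λ v → gains v p

  count-∉ : ∀ {es w} → (∀ u → (u , w) ∉ es) → count es w ≡ 0
  count-∉ {es} {w} ∉ = trans (∑-cong-∈ es (λ { {u , w′} p → 𝟙-no (w ≟ w′) λ { refl → ∉ u p } })) (∑-zero es)

  countAll-correct : ∀ vs rest {o q k z X} → V ≡ vs ++ rest → Outer.j o ≡ ∑ vs d → Processed vs X →
    Exec countAll (state o q k z X) (1 + ∑ rest vertexCost) λ s →
      ∃[ o′ ] ∃[ q′ ] ∃[ k′ ] ∃[ z′ ] ∃[ X′ ] (s ≡ state o′ q′ k′ z′ X′ × Processed V X′)
  countAll-correct vs [] {X = X} eq refl inv = exec-stop
    (λ h → <-irrefl (sym (trans m₂-∑ (cong (λ vs → ∑ vs d) (trans eq (++-identityʳ vs))))) h)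
    (_ , _ , _ , _ , _ , refl , subst (λ vs → Processed vs X) (trans (sym (++-identityʳ vs)) (sym eq)) inv)
  countAll-correct vs (v ∷ rest) {o} {q} {k} {z} {X} eq ej (zeros , owners , gs , twins) = visit (0 <? d v)
    where
    Post = λ s → ∃[ o′ ] ∃[ q′ ] ∃[ k′ ] ∃[ z′ ] ∃[ X′ ] (s ≡ state o′ q′ k′ z′ X′ × Processed V X′)
    eq′ : V ≡ (vs ++ v ∷ []) ++ rest
    eq′ = trans eq (sym (++-assoc vs _ rest))
    b = λ p → ∑ vs λ v → gains v p
    visit : Dec (Live v) → Exec countAll (state o q k z X) (1 + ∑ (v ∷ rest) vertexCost) Post
    visit (no ¬live) = weakenᵗ (s≤s (m≤n+m _ (vertexCost v)))
      (countAll-correct (vs ++ v ∷ []) rest eq′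
        (trans ej (sym (trans (∑-∷ʳ d vs v) (trans (cong (∑ vs d +_) (n≤0⇒n≡0 (≮⇒≥ ¬live))) (+-identityʳ _)))))
        (zeros , owners ,
         (λ c p cp → trans (gs c p cp) (sym (trans (∑-∷ʳ (λ v → gains v p) vs v)
           (trans (cong (b p +_) (cong (λ us → ∑ (concatMap (spokes v) us) (gain v p)) (isolated ¬live))) (+-identityʳ _))))) ,
         λ v′ u v∈ a u◁v → case ∈-++⁻ vs v∈ of λ
           { (inj₁ p) → twins v′ u p a u◁v
           ; (inj₂ (here refl)) → contradiction (Adj⇒Live a) ¬live }))
    visit (yes live) = weakenᵗ time (go o (trans ej (sym (offset-split vs eq))))
      where
      C = ∑ (nbrs v) (cost v)
      time : suc (3 + ((1 + (1 + C)) + ((1 + (1 + C)) + ((1 + (1 + C)) + 1))) + (1 + ∑ rest vertexCost)) ≤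
             1 + ∑ (v ∷ rest) vertexCost
      time = begin
        suc (3 + ((1 + (1 + C)) + ((1 + (1 + C)) + ((1 + (1 + C)) + 1))) + (1 + ρ)) ≡⟨ arith C ρ ⟩
        1 + (1 * 11 + 3 * C + ρ)
          ≤⟨ s≤s (+-monoˡ-≤ ρ (+-monoˡ-≤ (3 * C) (*-monoˡ-≤ 11 (subst (1 ≤_) (sym (length-nbrs v)) live)))) ⟩
        1 + (length (nbrs v) * 11 + 3 * C + ρ)  ≡⟨ cong (λ x → 1 + (x + ρ)) (cong₂ _+_ (∑-const (nbrs v) 11) (∑-*ˡ 3 (cost v) (nbrs v))) ⟨
        1 + (∑ (nbrs v) (λ _ → 11) + ∑ (nbrs v) (λ u → 3 * cost v u) + ρ) ≡⟨ cong (λ x → 1 + (x + ρ)) (∑-+ (λ _ → 11) (λ u → 3 * cost v u) (nbrs v)) ⟨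
        1 + (vertexCost v + ρ)                  ∎
        where
        open ≤-Reasoning
        ρ = ∑ rest vertexCost
        arith : ∀ C R → suc (3 + ((1 + (1 + C)) + ((1 + (1 + C)) + ((1 + (1 + C)) + 1))) + (1 + R)) ≡ 1 + (1 * 11 + 3 * C + R)
        arith =
          solve 2 (λ C R → con 1 :+ (con 3 :+ ((con 2 :+ C) :+ ((con 2 :+ C) :+ ((con 2 :+ C) :+ con 1))) :+ (con 1 :+ R)) :=
                                 con 1 :+ (con 11 :+ con 3 :* C :+ R)) refl
          where open +-*-Solver
      j<m₂ : offset v < m₂
      j<m₂ = []=⇒<m₂ (proj₂ (first-cell live))
      go : ∀ o → Outer.j o ≡ offset v → Exec countAll (state o q k z X) _ Post
      go (outer _ _ _ _) refl = exec-loop j<m₂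
        (step (eval-load-≡ (<m₂⇒<S j<m₂) (owners v live)) (toℕ<W v)
        (step (eval-input (degreeArray-[]= v)) (≤n⇒<W (degree≤n v))
        (step add (≤m₂⇒<W (offset+degree≤m₂ v))
        (exec-seq (weaken ≤-refl (λ { (_ , _ , _ , X₁ , refl , counts , extras , owners₁ , gs₁ , twins₁) →
         exec-seq (weaken ≤-refl (λ { (_ , _ , _ , X₂ , refl , counts , extras , owners₂ , twins₂ , gs₂) →
         exec-seq (weaken ≤-refl (λ { (_ , _ , _ , X₃ , refl , cleared , owners₃ , gs₃ , twins₃ , new) →
         exec-≔ copy (≤m₂⇒<W (offset+degree≤m₂ v))
           (countAll-correct (vs ++ v ∷ []) rest eq′
             (trans (cong (_+ d v) (offset-split vs eq)) (sym (∑-∷ʳ d vs v)))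
             ((λ w live → [ id , (λ (e , ∉) → trans e (count-∉ {wedges v} ∉)) ]′ (cleared w live)) , owners₃ ,
              (λ c p cp → trans (gs₃ c p cp) (sym (∑-∷ʳ (λ v → gains v p) vs v))) ,
              λ v′ u v∈ a u◁v → case ∈-++⁻ vs v∈ of λ
                { (inj₁ p) → twins₃ v′ u p a u◁v
                ; (inj₂ (here refl)) → new u (∈-wedges⁺ a u◁v (symmetric a)) }) ) })
           (scanWedges-correct {I = Counting₃ v vs (λ p → b p + gains v p)} resetWedge-preserves
             ((λ w live → inj₂ (counts w live , λ _ ())) , owners₂ , gs₂ , twins₂ , λ _ ()))) })
           (scanWedges-correct {I = Counting₂ v vs b} (addGains-preserves (gains-prefix eq))
             (counts , extras , owners₁ , twins₁ , λ c p cp → trans (gs₁ c p cp) (sym (+-identityʳ (b p)))))) })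
           (scanWedges-correct {I = Counting₁ vs b} countWedge-preserves
             (zeros , (λ _ ()) , owners , gs , twins)))))))

  Processed⇒Twin : ∀ {X} → Processed V X → ∀ {a b} → Adj a b → Twin (twin X) (a , b)
  Processed⇒Twin (_ , _ , _ , twins) {a} {b} ab with ◁-total {a} {b} (λ e → irreflexive e ab)
  ... | inj₁ a◁b = proj₂ (twins b a (∈-allFin b) (symmetric ab) a◁b)
  ... | inj₂ b◁a = proj₁ (twins a b (∈-allFin a) ab b◁a)

  Combined : List (Fin n × Fin n) → Vec ℕ S → Set
  Combined ps A = ∀ c p → c < length ps → cells [ c ]= p → get A c ≡ uncurry (□ G) p

  combine-correct : ∀ ps rest {o q k z X} → cells ≡ ps ++ rest → k ≡ length ps → Processed V X → Combined ps (out X) →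
    Exec combine (state o q k z X) (1 + length rest * 7) λ s →
      ∃[ q′ ] ∃[ k′ ] ∃[ z′ ] ∃[ X′ ] (s ≡ state o q′ k′ z′ X′ × Combined cells (out X′))
  combine-correct ps [] {X = X} eq refl _ inv = exec-stop
    (λ h → <-irrefl (trans (cong length (trans (sym (++-identityʳ ps)) (sym eq))) length-cells) h)
    (_ , _ , _ , _ , refl , subst (λ ps → Combined ps (out X)) (trans (sym (++-identityʳ ps)) (sym eq)) inv)
  combine-correct ps ((u , w) ∷ rest) {X = X} eq refl pr@(_ , _ , gs , _) inv = exec-loop ([]=⇒<m₂ at)
    (step (eval-load (cell<S at)) (≤m₂⇒<W (<⇒≤ ([]=⇒<m₂ at′)))
    (step (eval-load (cell<S at)) (N⁷⇒<W (≤-trans (m≤m+n _ _) bound))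
    (step (eval-load (cell<S at′)) (N⁷⇒<W (≤-trans (m≤n+m _ (get (credit X) (length ps))) bound))
    (step add (N⁷⇒<W bound)
    (stepˢ (cell<S at)
    (exec-≔ add (≤m₂⇒<W (subst (_≤ m₂) (+-comm 1 _) ([]=⇒<m₂ at)))
      (combine-correct (ps ++ (u , w) ∷ []) rest {X = memory _ _ _ _ _ _}
        (trans eq (sym (++-assoc ps _ rest))) (sym (length-++ ps)) pr inv′)))))))
    where
    at : cells [ length ps ]= (u , w)
    at = []=-split ps eq
    at′ : cells [ get (twin X) (length ps) ]= (w , u)
    at′ = Processed⇒Twin {X} pr (cells-Adj at) (length ps) at
    value = get (credit X) (length ps) + get (credit X) (get (twin X) (length ps))
    value-total : value ≡ total (u , w) + total (w , u)
    value-total = cong₂ _+_ (gs _ _ at) (gs _ _ at′)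
    N⁷⇒<W : ∀ {a} → a ≤ N ^ 7 → a < W
    N⁷⇒<W a≤ = ≤-<-trans a≤ (N^k<W 7 (s≤s (s≤s (s≤s (s≤s (s≤s (s≤s (s≤s (s≤s z≤n)))))))))
    bound : value ≤ N ^ 7
    bound = begin
      value                         ≡⟨ value-total ⟩
      total (u , w) + total (w , u) ≤⟨ +-mono-≤ (total≤ (u , w)) (total≤ (w , u)) ⟩
      N ^ 6 + N ^ 6                 ≡⟨ cong (N ^ 6 +_) (+-identityʳ (N ^ 6)) ⟨
      2 * N ^ 6                     ≤⟨ *-monoˡ-≤ (N ^ 6) 2≤N ⟩
      N ^ 7                         ∎
      where open ≤-Reasoning
    inv′ : Combined (ps ++ (u , w) ∷ []) (set (out X) (length ps) value)
    inv′ c p c< cp with c ℕ.≟ length ps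
    ... | yes refl with refl ← []=-functional cp at =
      trans (get-set-≡ (out X) value (cell<S at)) (trans value-total (total-□ u w))
    inv′ c p c< cp | no ne = trans (get-set-≢ (out X) value (≢-sym ne))
      (inv c p (≤∧≢⇒< (≤-pred (≤-trans c< (≤-reflexive (trans (length-++ ps) (+-comm _ 1))))) ne) cp)

  runtime : ℕ
  runtime = 1 + (1 + (1 + ((1 + m₂ * 8) + (1 + ((1 + ∑ V vertexCost) + (1 + (1 + m₂ * 7)))))))

  algorithm-correct : ∀ s → Exec algorithm s runtime λ s′ →
    take m₂ (toList (lookup (State.work s′) aOut)) ≡ edgeCounts L
  algorithm-correct
    ⟨ _ ∷ _ ∷ _ ∷ _ ∷ _ ∷ _ ∷ _ ∷ _ ∷ _ ∷ _ ∷ _ ∷ _ ∷ _ ∷ _ ∷ _ ∷ _ ∷ [] , _ ∷ _ ∷ _ ∷ _ ∷ _ ∷ _ ∷ [] ⟩ =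
    step const 1<W
    (step size (≤m₂⇒<W ≤-refl)
    (step const 0<W
    (exec-seq (weaken (≤-reflexive (cong (λ l → 1 + l * 8) length-cells))
      (λ { (_ , _ , _ , X₁ , refl , initialised) →
        step const 0<W
        (exec-seq (weaken ≤-refl
          (λ { (_ , _ , _ , _ , X₂ , refl , processed) →
            step const 0<W
            (weaken (≤-reflexive (cong (λ l → 1 + l * 7) length-cells))
              (λ { (_ , _ , _ , X₃ , refl , combined) →
                trans (cong (λ l → take l (toList (out X₃))) (sym length-counts))
                  (take-toList (edgeCounts L) (out X₃)
                    (≤-trans (≤-reflexive length-counts) (m≤n+m m₂ n))
                    (counts-[]= {out X₃} combined)) })
              (combine-correct [] cells refl refl processed λ _ _ ())) })
          (countAll-correct [] V {X = X₁} refl refl (Initialised⇒Processed {X₁} initialised)))) })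
      (initialise-correct [] cells {o = outer _ _ _ _} {middle _ _ _ _} {0} {temporaries _ _ _ _ _} {memory _ _ _ _ _ _}
        refl refl ((λ _ _ ()) , λ _ ()))))))
    where
    length-counts : length (edgeCounts L) ≡ m₂
    length-counts = trans (cong length edgeCounts-cells) (trans (length-map _ cells) length-cells)
    []=-map⁻ : ∀ {A B : Set} {f : A → B} xs {c y} → map f xs [ c ]= y → ∃[ x ] (xs [ c ]= x × y ≡ f x)
    []=-map⁻ (x ∷ _)  here      = x , here , refl
    []=-map⁻ (_ ∷ xs) (there p) = let x , q , e = []=-map⁻ xs p in x , there q , e
    counts-[]= : ∀ {A} → Combined cells A → ∀ {c x} → edgeCounts L [ c ]= x → get A c ≡ x
    counts-[]= combined p with []=-map⁻ cells (subst (λ xs → xs [ _ ]= _) edgeCounts-cells p)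
    ... | q , cq , refl = combined _ q ([]=⇒< cq) cq

-- Time and space

fromℕ-mono : ∀ {a b} → a ≤ b → fromℕ a ℚ.≤ fromℕ b
fromℕ-mono {a} {b} a≤b = ℚₚ.toℚᵘ-cancel-≤ (begin
  ℚ.toℚᵘ (fromℕ a)  ≃⟨ ℚₚ.toℚᵘ-fromℚᵘ (mkℚᵘ (ℤ.+ a) 0) ⟩
  mkℚᵘ (ℤ.+ a) 0      ≤⟨ ℚᵘ.*≤* (ℤₚ.*-monoʳ-≤-nonNeg (ℤ.+ 1) (ℤ.+≤+ a≤b)) ⟩
  mkℚᵘ (ℤ.+ b) 0      ≃⟨ ℚₚ.toℚᵘ-fromℚᵘ (mkℚᵘ (ℤ.+ b) 0) ⟨
  ℚ.toℚᵘ (fromℕ b)  ∎)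
  where open ℚᵘₚ.≤-Reasoning

fromℚᵘ-* : ∀ p q r → p ℚᵘ.* q ℚᵘ.≃ r → ℚ.fromℚᵘ p ℚ.* ℚ.fromℚᵘ q ≡ ℚ.fromℚᵘ r
fromℚᵘ-* p q r eq = ℚₚ.toℚᵘ-injective (begin-equality
  ℚ.toℚᵘ (ℚ.fromℚᵘ p ℚ.* ℚ.fromℚᵘ q)                ≃⟨ ℚₚ.toℚᵘ-homo-* (ℚ.fromℚᵘ p) (ℚ.fromℚᵘ q) ⟩
  ℚ.toℚᵘ (ℚ.fromℚᵘ p) ℚᵘ.* ℚ.toℚᵘ (ℚ.fromℚᵘ q)      ≃⟨ ℚᵘₚ.*-cong (ℚₚ.toℚᵘ-fromℚᵘ p) (ℚₚ.toℚᵘ-fromℚᵘ q) ⟩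
  p ℚᵘ.* q                                          ≃⟨ eq ⟩
  r                                                 ≃⟨ ℚₚ.toℚᵘ-fromℚᵘ r ⟨
  ℚ.toℚᵘ (ℚ.fromℚᵘ r)                               ∎)
  where open ℚᵘₚ.≤-Reasoning

fromℕ-* : ∀ a b → fromℕ (a * b) ≡ fromℕ a ℚ.* fromℕ b
fromℕ-* a b = sym (fromℚᵘ-* (mkℚᵘ (ℤ.+ a) 0) (mkℚᵘ (ℤ.+ b) 0) (mkℚᵘ (ℤ.+ (a * b)) 0)
  (*≡* (cong (ℤ._* ℤ.+ 1) (sym (ℤₚ.pos-* a b)))))

fromℕ-*-÷ : ∀ a s → fromℕ (suc a) ℚ.* (s ÷ suc a) ≡ fromℕ s
fromℕ-*-÷ a s = fromℚᵘ-* (mkℚᵘ (ℤ.+ suc a) 0) (mkℚᵘ (ℤ.+ s) a) (mkℚᵘ (ℤ.+ s) 0)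
  (*≡* (trans (ℤₚ.*-identityʳ _) (trans (ℤₚ.*-comm (ℤ.+ suc a) (ℤ.+ s)) (cong (λ b → ℤ.+ s ℤ.* ℤ.+ suc b) (sym (+-identityʳ a))))))

fromℕ-1⊔ : ∀ s → fromℕ (1 ⊔ s) ℚ.≤ 1ℚ ℚ.⊔ fromℕ s
fromℕ-1⊔ zero    = ℚₚ.p≤p⊔q 1ℚ (fromℕ 0)
fromℕ-1⊔ (suc s) = ℚₚ.p≤q⊔p 1ℚ (fromℕ (suc s))

module _ {n : ℕ} (G : Graph n) (L : AdjacencyLists G) where
  open Graph G
  open AdjacencyLists L
  open Correctness G L

  private
    E = edges G

  minSum : ℕ
  minSum = ∑ E λ (u , v) → d u ⊓ d v

  edgeCount*averageDegeneracy : fromℕ (edgeCount G) ℚ.* averageDegeneracy G ≡ fromℕ minSum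
  edgeCount*averageDegeneracy with edges G
  ... | []     = refl
  ... | e ∷ es = fromℕ-*-÷ (length es) (∑ (e ∷ es) λ (u , v) → d u ⊓ d v)

  m₂≡2m : m₂ ≡ edgeCount G * 2
  m₂≡2m = begin
    m₂                                  ≡⟨ m₂-∑ ⟩
    ∑ V d
      ≡⟨ ∑-cong (λ v → trans (sym (length-nbrs v)) (length-∑ (nbrs v))) V ⟩
    ∑ V (λ v → ∑ (nbrs v) (λ _ → 1))    ≡⟨ ∑-darts (λ _ _ → 1) ⟩
    ∑ E (λ _ → 2)                       ≡⟨ ∑-const E 2 ⟩
    edgeCount G * 2                     ∎
    where open ≡-Reasoning

  dartCost : Fin n → Fin n → ℕ
  dartCost v u = 15 + (11 + 3 * cost v u)

  edge-cost : ∀ {u v} → Adj u v → dartCost u v + dartCost v u ≤ 181 * (d u ⊓ d v)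
  edge-cost {u} {v} uv = begin
    dartCost u v + dartCost v u
      ≡⟨ arith (𝟙 (v ◁? u) * (d v * 17)) (𝟙 (u ◁? v) * (d u * 17)) ⟩
    130 + 3 * (𝟙 (v ◁? u) * (d v * 17) + 𝟙 (u ◁? v) * (d u * 17))
      ≤⟨ +-mono-≤ (*-monoʳ-≤ 130 1≤min) (*-monoʳ-≤ 3 (share (◁-total (λ e → irreflexive e uv)))) ⟩
    130 * min + 3 * (min * 17)                                    ≡⟨ arith′ min ⟩
    181 * min                                                     ∎
    where
    open ≤-Reasoning
    min = d u ⊓ d v
    1≤min : 1 ≤ min
    1≤min = ⊓-glb (Adj⇒Live uv) (Adj⇒Live (symmetric uv))
    share : u ◁ v ⊎ v ◁ u → 𝟙 (v ◁? u) * (d v * 17) + 𝟙 (u ◁? v) * (d u * 17) ≤ min * 17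
    share (inj₁ p) rewrite 𝟙-no (v ◁? u) (◁-asym p) | 𝟙-yes (u ◁? v) p | m≤n⇒m⊓n≡m (◁⇒degree-≤ p) =
      ≤-reflexive (*-identityˡ (d u * 17))
    share (inj₂ p) rewrite 𝟙-no (u ◁? v) (◁-asym p) | 𝟙-yes (v ◁? u) p | m≥n⇒m⊓n≡n (◁⇒degree-≤ p) =
      ≤-reflexive (trans (+-identityʳ _) (*-identityˡ (d v * 17)))
    open +-*-Solver
    arith : ∀ x y → 15 + (11 + 3 * (13 + x)) + (15 + (11 + 3 * (13 + y))) ≡ 130 + 3 * (x + y)
    arith =
      solve 2 (λ x y → con 15 :+ (con 11 :+ con 3 :* (con 13 :+ x)) :+ (con 15 :+ (con 11 :+ con 3 :* (con 13 :+ y))) :=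
                             con 130 :+ con 3 :* (x :+ y)) refl
    arith′ : ∀ m → 130 * m + 3 * (m * 17) ≡ 181 * m
    arith′ = solve 1 (λ m → con 130 :* m :+ con 3 :* (m :* con 17) := con 181 :* m) refl

  runtime-bound : runtime ≤ 200 * (1 ⊔ minSum)
  runtime-bound = begin
    runtime                                              ≡⟨ arith m₂ (∑ V vertexCost) ⟩
    8 + (15 * m₂ + ∑ V vertexCost)
      ≡⟨ cong (λ x → 8 + (15 * x + ∑ V vertexCost)) m₂-∑ ⟩
    8 + (15 * ∑ V d + ∑ V vertexCost)                    ≡⟨ cong (λ x → 8 + (x + ∑ V vertexCost)) (∑-*ˡ 15 d V) ⟨
    8 + (∑ V (λ v → 15 * d v) + ∑ V vertexCost)          ≡⟨ cong (8 +_) (∑-+ (λ v → 15 * d v) vertexCost V) ⟨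
    8 + ∑ V (λ v → 15 * d v + vertexCost v)              ≡⟨ cong (8 +_) (∑-cong at-vertex V) ⟩
    8 + ∑ V (λ v → ∑ (nbrs v) (dartCost v))              ≡⟨ cong (8 +_) (∑-darts dartCost) ⟩
    8 + ∑ E (λ (u , v) → dartCost u v + dartCost v u)    ≤⟨ +-monoʳ-≤ 8 (∑-mono-∈ E λ {p} p∈ →
                                                              edge-cost (proj₂ (proj₂ (∈-filter⁻ _ {xs = cartesianProduct V V} p∈)))) ⟩
    8 + ∑ E (λ (u , v) → 181 * (d u ⊓ d v))
      ≡⟨ cong (8 +_) (∑-*ˡ 181 (λ (u , v) → d u ⊓ d v) E) ⟩
    8 + 181 * minSum
      ≤⟨ +-mono-≤ (*-monoʳ-≤ 8 (m≤m⊔n 1 minSum)) (*-monoʳ-≤ 181 (m≤n⊔m 1 minSum)) ⟩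
    8 * (1 ⊔ minSum) + 181 * (1 ⊔ minSum)                ≡⟨ *-distribʳ-+ (1 ⊔ minSum) 8 181 ⟨
    189 * (1 ⊔ minSum)                                   ≤⟨ *-monoˡ-≤ (1 ⊔ minSum) (m≤m+n 189 11) ⟩
    200 * (1 ⊔ minSum)                                   ∎
    where
    open ≤-Reasoning
    at-vertex : ∀ v → 15 * d v + vertexCost v ≡ ∑ (nbrs v) (dartCost v)
    at-vertex v =
      trans (cong (_+ vertexCost v) (trans (*-comm 15 (d v)) (trans (cong (_* 15) (sym (length-nbrs v))) (sym (∑-const (nbrs v) 15)))))
                        (sym (∑-+ (λ _ → 15) (λ u → 11 + 3 * cost v u) (nbrs v)))
    arith : ∀ m c → 1 + (1 + (1 + ((1 + m * 8) + (1 + ((1 + c) + (1 + (1 + m * 7))))))) ≡ 8 + (15 * m + c)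
    arith =
      solve 2 (λ m c → con 1 :+ (con 1 :+ (con 1 :+ ((con 1 :+ m :* con 8) :+ (con 1 :+ ((con 1 :+ c) :+ (con 1 :+ (con 1 :+ m :* con 7))))))) :=
                             con 8 :+ (con 15 :* m :+ c)) refl
      where open +-*-Solver

  space-bound : 16 + 6 * S ≤ 200 * (1 ⊔ (edgeCount G + n))
  space-bound = begin
    16 + 6 * (n + m₂)                  ≡⟨ cong (λ x → 16 + 6 * (n + x)) m₂≡2m ⟩
    16 + 6 * (n + edgeCount G * 2)
      ≤⟨ +-monoʳ-≤ 16 (*-monoʳ-≤ 6 (+-monoˡ-≤ (edgeCount G * 2) (≤-trans (≤-reflexive (sym (*-identityʳ n))) (*-monoʳ-≤ n (s≤s z≤n))))) ⟩
    16 + 6 * (n * 2 + edgeCount G * 2) ≡⟨ cong (λ x → 16 + 6 * x) (*-distribʳ-+ 2 n (edgeCount G)) ⟨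
    16 + 6 * ((n + edgeCount G) * 2)   ≡⟨ cong (λ x → 16 + 6 * (x * 2)) (+-comm n (edgeCount G)) ⟩
    16 + 6 * (M * 2)
      ≡⟨ cong (λ x → 16 + x) (trans (cong (6 *_) (*-comm M 2)) (sym (*-assoc 6 2 M))) ⟩
    16 + 12 * M                        ≤⟨ +-mono-≤ (*-monoʳ-≤ 16 (m≤m⊔n 1 M)) (*-monoʳ-≤ 12 (m≤n⊔m 1 M)) ⟩
    16 * (1 ⊔ M) + 12 * (1 ⊔ M)        ≡⟨ *-distribʳ-+ (1 ⊔ M) 16 12 ⟨
    28 * (1 ⊔ M)                       ≤⟨ *-monoˡ-≤ (1 ⊔ M) (m≤m+n 28 172) ⟩
    200 * (1 ⊔ M)                      ∎
    where
    open ≤-Reasoning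
    M = edgeCount G + n

  time-bound : ∀ {t} → t ≤ runtime →
    fromℕ t ℚ.≤ fromℕ 200 ℚ.* (1ℚ ℚ.⊔ (fromℕ (edgeCount G) ℚ.* averageDegeneracy G))
  time-bound {t} t≤ = begin
    fromℕ t                                ≤⟨ fromℕ-mono (≤-trans t≤ runtime-bound) ⟩
    fromℕ (200 * (1 ⊔ minSum))             ≡⟨ fromℕ-* 200 (1 ⊔ minSum) ⟩
    fromℕ 200 ℚ.* fromℕ (1 ⊔ minSum)       ≤⟨ ℚₚ.*-monoˡ-≤-nonNeg (fromℕ 200) (fromℕ-1⊔ minSum) ⟩
    fromℕ 200 ℚ.* (1ℚ ℚ.⊔ fromℕ minSum)    ≡⟨ cong (λ x → fromℕ 200 ℚ.* (1ℚ ℚ.⊔ x)) edgeCount*averageDegeneracy ⟨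
    fromℕ 200 ℚ.* (1ℚ ℚ.⊔ (fromℕ (edgeCount G) ℚ.* averageDegeneracy G)) ∎
    where open ℚₚ.≤-Reasoning

theorem3 : ∃[ r ] ∃[ k ] Σ[ P ∈ Program 3 r k ] Σ[ out ∈ Fin k ] ∃[ c ] ∃[ w ]
    (∀ (n : ℕ) (G : Graph n) (L : AdjacencyLists G) →
    ∃[ S ] ((r + k * S ≤ c * (1 ⊔ (edgeCount G + n))) ×
    (∀ (s : State r k S) →
    ∃[ t ] ∃[ s′ ] (
    Semantics.Run (encode L) S ((2 + n) ^ w) P s t s′ ×
    (fromℕ t ℚ.≤ fromℕ c ℚ.* (1ℚ ℚ.⊔ (fromℕ (edgeCount G) ℚ.* averageDegeneracy G))) ×
    (take (length (adjacencyArray L)) (toList (lookup (State.work s′) out)) ≡ edgeCounts L)))))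
theorem3 = 16 , 6 , algorithm , aOut , 200 , 8 , λ n G L →
  Correctness.S G L , space-bound G L , λ s →
    let t , s′ , halts , t≤ , correct = Correctness.algorithm-correct G L s
    in t , s′ , halts , time-bound G L t≤ , correct
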